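{- Let $m\geq 2$ be an integer and $H$ be a connected graph of order $n$. If $G=P_m\Box H$, then $p(G)\leq \frac{n(G)}{2}$, where $n(G)=mn$ is the order of $G$.
   Context: All graphs are finite, simple and undirected. $P_m$ is the path on $m$ vertices. A path decomposition of a graph $G$ is a collection of edge-disjoint paths covering all edges of $G$; $p(G)$ denotes the minimum number of paths in a path decomposition of $G$. The Cartesian product $G\Box H$ has vertex set $V(G)\times V(H)$, with $(u_1,v_1)(u_2,v_2)$ an edge iff either $u_1u_2\in E(G)$ and $v_1=v_2$, or $v_1v_2\in E(H)$ and $u_1=u_2$. -}

module Defs where

open import Data.Nat using (ℕ; zero; suc; _≤_; _*_)

import Data.Nat.Properties as ℕP
open import Data.Fin using (Fin; toℕ)
import Data.Fin.Properties as FinP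
open import Data.Bool using (Bool; true; false; _∨_; _∧_)
open import Data.Bool.Properties using (∨-comm)
open import Data.Product using (Σ; _×_; _,_)
open import Data.List using (List; []; _∷_; length; lookup)
open import Data.List.Relation.Unary.Unique.Propositional using (Unique)
open import Relation.Binary.PropositionalEquality using (_≡_; _≢_; refl; sym; cong₂)
open import Relation.Nullary using (yes; no)
open import Relation.Nullary.Decidable using (⌊_⌋)
open import Data.Empty using (⊥; ⊥-elim)

record Graph (V : Set) : Set where
  field
    adj      : V → V → Bool
    adj-sym  : ∀ u v → adj u v ≡ adj v u
    adj-irr  : ∀ v → adj v v ≡ false
open Graph public

data Walk {V : Set} (G : Graph V) : V → V → Set where
  nil  : ∀ {v} → Walk G v v
  cons : ∀ {u w v} → adj G u w ≡ true → Walk G w v → Walk G u v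

Connected : {V : Set} → Graph V → Set
Connected G = ∀ u v → Walk G u v

P-adj : ∀ m → Fin m → Fin m → Bool
P-adj m i j = ⌊ toℕ j ℕP.≟ suc (toℕ i) ⌋ ∨ ⌊ toℕ i ℕP.≟ suc (toℕ j) ⌋

P-sym : ∀ m (i j : Fin m) → P-adj m i j ≡ P-adj m j i
P-sym m i j = ∨-comm ⌊ toℕ j ℕP.≟ suc (toℕ i) ⌋ ⌊ toℕ i ℕP.≟ suc (toℕ j) ⌋

P-irr : ∀ m (i : Fin m) → P-adj m i i ≡ false
P-irr m i with toℕ i ℕP.≟ suc (toℕ i)
... | yes e = ⊥-elim (ℕP.<-irrefl e (ℕP.n<1+n (toℕ i)))
... | no _ = refl

P : (m : ℕ) → Graph (Fin m)
P m = record { adj = P-adj m ; adj-sym = P-sym m ; adj-irr = P-irr m }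

□-adj : ∀ {m n} → Graph (Fin m) → Graph (Fin n) → Fin m × Fin n → Fin m × Fin n → Bool
□-adj G H (u₁ , v₁) (u₂ , v₂) =
  (adj G u₁ u₂ ∧ ⌊ v₁ FinP.≟ v₂ ⌋) ∨ (adj H v₁ v₂ ∧ ⌊ u₁ FinP.≟ u₂ ⌋)

private
  ≟-sym : ∀ {n} (a b : Fin n) → ⌊ a FinP.≟ b ⌋ ≡ ⌊ b FinP.≟ a ⌋
  ≟-sym a b with a FinP.≟ b | b FinP.≟ a
  ... | yes _ | yes _ = refl
  ... | no _  | no _  = refl
  ... | yes e | no ne = ⊥-elim (ne (sym e))
  ... | no ne | yes e = ⊥-elim (ne (sym e))

  ≟-refl : ∀ {n} (a : Fin n) → ⌊ a FinP.≟ a ⌋ ≡ true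
  ≟-refl a with a FinP.≟ a
  ... | yes _ = refl
  ... | no ne = ⊥-elim (ne refl)

□-sym : ∀ {m n} (G : Graph (Fin m)) (H : Graph (Fin n)) x y → □-adj G H x y ≡ □-adj G H y x
□-sym G H (u₁ , v₁) (u₂ , v₂) =
  cong₂ _∨_ (cong₂ _∧_ (adj-sym G u₁ u₂) (≟-sym v₁ v₂))
            (cong₂ _∧_ (adj-sym H v₁ v₂) (≟-sym u₁ u₂))

□-irr : ∀ {m n} (G : Graph (Fin m)) (H : Graph (Fin n)) x → □-adj G H x x ≡ false
□-irr G H (u , v) rewrite adj-irr G u | adj-irr H v = refl

_□_ : ∀ {m n} → Graph (Fin m) → Graph (Fin n) → Graph (Fin m × Fin n)
G □ H = record { adj = □-adj G H ; adj-sym = □-sym G H ; adj-irr = □-irr G H }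

data Linked {V : Set} (G : Graph V) : List V → Set where
  one  : ∀ {x} → Linked G (x ∷ [])
  step : ∀ {x y xs} → adj G x y ≡ true → Linked G (y ∷ xs) → Linked G (x ∷ y ∷ xs)

record IsPath {V : Set} (G : Graph V) (ps : List V) : Set where
  field
    nontrivial : 2 ≤ length ps
    distinct   : Unique ps
    linked     : Linked G ps

data EdgeIn {V : Set} : List V → V → V → Set where
  fwd   : ∀ {x y xs} → EdgeIn (x ∷ y ∷ xs) x y
  bwd   : ∀ {x y xs} → EdgeIn (x ∷ y ∷ xs) y x
  there : ∀ {x xs u v} → EdgeIn xs u v → EdgeIn (x ∷ xs) u v

record IsPathDecomposition {V : Set} (G : Graph V) (D : List (List V)) : Set where
  field
    paths    : ∀ i → IsPath G (lookup D i)
    covers   : ∀ u v → adj G u v ≡ true → Σ (Fin (length D)) λ i → EdgeIn (lookup D i) u v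
    disjoint : ∀ i j u v → i ≢ j → EdgeIn (lookup D i) u v → EdgeIn (lookup D j) u v → ⊥

PathNumberAtMost : {V : Set} → Graph V → ℕ → Set
PathNumberAtMost G k = Σ (List (List _)) λ D → IsPathDecomposition G D × length D ≤ k

{-# OPTIONS --safe #-}

-- The proof splits into a statement about H alone and a layer-by-layer assembly.
--
-- H has a decomposition into paths (one-vertex paths allowed) in which every vertex is an end once
-- or twice, according to the parity of its degree.  Edges are added one at a time as in Lovász's
-- theorem: if every neighbour of u, and x itself, is an end of some path, then the edge ux can be
-- added at the cost of moving one path end from x to u.  Indeed a path ending at x can be extended
-- to u unless it already passes through u, say along yu; in that case replace yu by xu and continue
-- with y in place of x.  Since no vertex is an end three times, the paths can be oriented so that
-- each vertex starts at most one and finishes at most one.  Hence there are paths A v starting at v,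
-- for all v, whose final vertices coincide at most in pairs.
--
-- In P_m □ H, n paths climb through the layers, one along each vertical edge; a path that arrives
-- at v follows A v in the new layer and climbs on from the final vertex of A v.  The bottom layer is
-- traversed by the reverses of A v.  In each of the m − 2 inner layers at most n/2 paths have to stop
-- since another path climbs from the same vertex, and all n stop in the top layer; this makes at most
-- n + (m − 2) n/2 paths.  They are simple because they meet each layer in a subpath of some A v.

module Submission where

open import Defs
open import Data.Nat using (ℕ; _≤_; _*_)
open import Data.Fin using (Fin)
open import Data.List using (List; length)
open import Data.Product using (Σ; _×_)

open import Data.Bool using (Bool; true; false; if_then_else_; _∧_; _∨_)
open import Data.Empty using (⊥-elim)
open import Data.Fin using (zero; suc; toℕ)
import Data.Fin.Properties as Fin
open import Data.List using
  ([]; _∷_; _++_; _∷ʳ_; map; concatMap; reverse; replicate; lookup; take; drop; filter; allFin)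
open import Data.List.Properties using
  (map-++; map-tabulate; reverse-map; reverse-involutive; unfold-reverse; ++-assoc; length-++; length-map; length-tabulate)
open import Data.List.Relation.Binary.Permutation.Propositional using (_↭_; ↭-refl; ↭-trans; prep; swap)
open import Data.List.Relation.Binary.Permutation.Propositional.Properties using (map⁺; All-resp-↭; ↭-length)
open import Data.List.Relation.Unary.All using (All; []; _∷_; uncons; universal)
import Data.List.Relation.Unary.All.Properties as All
open import Data.List.Relation.Unary.AllPairs using ([]; _∷_)
open import Data.List.Relation.Unary.Unique.Propositional using (Unique)
open import Data.Nat using (zero; suc; _+_; _∸_; z≤n; s≤s; _≟_)
open import Data.Nat.Divisibility using (_∣_; divides; ∣m+n∣m⇒∣n; m∣m*n)
open import Data.Nat.ListAction using (sum)
open import Data.Nat.ListAction.Properties using (sum-++; sum-↭)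
open import Data.Nat.Properties hiding (_≟_)
open import Data.Nat.Tactic.RingSolver using (solve-∀)
open import Data.Product using (∃; ∃₂; _,_; proj₁; proj₂)
open import Data.Sum using (_⊎_; inj₁; inj₂; [_,_])
open import Relation.Binary.Definitions using (DecidableEquality; tri<; tri≈; tri>)
open import Relation.Binary.PropositionalEquality using
  (_≡_; _≢_; refl; sym; trans; cong; cong₂; subst; subst₂; module ≡-Reasoning)
open import Relation.Nullary using (Dec; yes; no; does)
open import Relation.Nullary.Decidable using (⌊_⌋; isYes≗does; dec-true; dec-false; map′; _×-dec_)

-- Sums of natural-number functions over lists.

∑ : {A : Set} → (A → ℕ) → List A → ℕ
∑ f l = sum (map f l)

∑-++ : {A : Set} (f : A → ℕ) (l r : List A) → ∑ f (l ++ r) ≡ ∑ f l + ∑ f r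
∑-++ f l r rewrite map-++ f l r = sum-++ (map f l) (map f r)

∑-↭ : {A : Set} (f : A → ℕ) {l r : List A} → l ↭ r → ∑ f l ≡ ∑ f r
∑-↭ f p = sum-↭ (map⁺ f p)

∑-cong : {A : Set} {f g : A → ℕ} → (∀ x → f x ≡ g x) → ∀ l → ∑ f l ≡ ∑ g l
∑-cong eq []      = refl
∑-cong eq (x ∷ l) = cong₂ _+_ (eq x) (∑-cong eq l)

∑-mono : {A : Set} {f g : A → ℕ} → (∀ x → f x ≤ g x) → ∀ l → ∑ f l ≤ ∑ g l
∑-mono le []      = z≤n
∑-mono le (x ∷ l) = +-mono-≤ (le x) (∑-mono le l)

∑-0 : {A : Set} (l : List A) → ∑ (λ _ → 0) l ≡ 0
∑-0 []      = refl
∑-0 (x ∷ l) = ∑-0 l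

+-interchange : ∀ a b c d → (a + b) + (c + d) ≡ (a + c) + (b + d)
+-interchange = solve-∀

∑-+ : {A : Set} (f g : A → ℕ) (l : List A) → ∑ (λ x → f x + g x) l ≡ ∑ f l + ∑ g l
∑-+ f g []      = refl
∑-+ f g (x ∷ l) rewrite ∑-+ f g l = +-interchange (f x) (g x) (∑ f l) (∑ g l)

∑-*ˡ : {A : Set} (c : ℕ) (f : A → ℕ) (l : List A) → ∑ (λ x → c * f x) l ≡ c * ∑ f l
∑-*ˡ c f []      = sym (*-zeroʳ c)
∑-*ˡ c f (x ∷ l) rewrite ∑-*ˡ c f l = sym (*-distribˡ-+ c (f x) (∑ f l))

∑-swap : {A B : Set} (f : A → B → ℕ) (l : List A) (r : List B) →
  ∑ (λ x → ∑ (f x) r) l ≡ ∑ (λ y → ∑ (λ x → f x y) l) r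
∑-swap f []      r = sym (∑-0 r)
∑-swap f (x ∷ l) r =
  trans (cong (∑ (f x) r +_) (∑-swap f l r)) (sym (∑-+ (f x) (λ y → ∑ (λ x → f x y) l) r))

∑-map : {A B : Set} (f : B → ℕ) (g : A → B) (l : List A) → ∑ f (map g l) ≡ ∑ (λ x → f (g x)) l
∑-map f g []      = refl
∑-map f g (x ∷ l) = cong (f (g x) +_) (∑-map f g l)

∑-concatMap : {A B : Set} (f : B → ℕ) (g : A → List B) (l : List A) →
  ∑ f (concatMap g l) ≡ ∑ (λ x → ∑ f (g x)) l
∑-concatMap f g []      = refl
∑-concatMap f g (x ∷ l) =
  trans (∑-++ f (g x) (concatMap g l)) (cong (∑ f (g x) +_) (∑-concatMap f g l))

∑-1 : {A : Set} (l : List A) → ∑ (λ _ → 1) l ≡ length l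
∑-1 []      = refl
∑-1 (x ∷ l) = cong suc (∑-1 l)

pos-+ : ∀ {a b} → 1 ≤ a + b → 1 ≤ a ⊎ 1 ≤ b
pos-+ {zero}  p = inj₂ p
pos-+ {suc a} p = inj₁ (s≤s z≤n)

-- Sums are invariant under permutation, so an item that contributes may be brought to the front
-- before the list is taken apart.
∑-pick : {A : Set} (f : A → ℕ) (l : List A) → 1 ≤ ∑ f l → ∃₂ λ x r → l ↭ x ∷ r × 1 ≤ f x
∑-pick f (x ∷ l) p with pos-+ {f x} p
... | inj₁ q = x , l , ↭-refl , q
... | inj₂ q with ∑-pick f l q
...   | y , r , l↭ , fy = y , x ∷ r , ↭-trans (prep x l↭) (swap x y ↭-refl) , fy

positive? : ∀ n → n ≡ 0 ⊎ 1 ≤ n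
positive? zero    = inj₁ refl
positive? (suc n) = inj₂ (s≤s z≤n)

-- Counting in vertex sequences.

-- Vertices, ends and edges of vertex sequences are counted by ℕ-valued indicator functions, so that
-- disjointness and covering become equations between sums.
module Counting {X : Set} (_≟_ : DecidableEquality X) where

  δ : X → X → ℕ
  δ x y = if does (x ≟ y) then 1 else 0

  δ-refl : ∀ x → δ x x ≡ 1
  δ-refl x with x ≟ x
  ... | yes _ = refl
  ... | no ne = ⊥-elim (ne refl)

  δ-≢ : ∀ {x y} → x ≢ y → δ x y ≡ 0
  δ-≢ {x} {y} ne with x ≟ y
  ... | yes e = ⊥-elim (ne e)
  ... | no _  = refl

  δ-pos : ∀ {x y} → 1 ≤ δ x y → x ≡ y
  δ-pos {x} {y} p with x ≟ y
  ... | yes e = e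

  δ-sym : ∀ x y → δ x y ≡ δ y x
  δ-sym x y with x ≟ y | y ≟ x
  ... | yes _ | yes _ = refl
  ... | no _  | no _  = refl
  ... | yes e | no ne = ⊥-elim (ne (sym e))
  ... | no ne | yes e = ⊥-elim (ne (sym e))

  δ≤1 : ∀ x y → δ x y ≤ 1
  δ≤1 x y with x ≟ y
  ... | yes _ = ≤-refl
  ... | no _  = z≤n

  hd : List X → X → ℕ
  hd []      v = 0
  hd (x ∷ _) v = δ x v

  ls : List X → X → ℕ
  ls []          v = 0
  ls (x ∷ [])    v = δ x v
  ls (_ ∷ y ∷ l) v = ls (y ∷ l) v

  ends : List X → X → ℕ
  ends l v = hd l v + ls l v

  occ : List X → X → ℕ
  occ l v = ∑ (λ x → δ x v) l

  -- Symmetrised product: for indicators of two distinct vertices it is the indicator of the edge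
  -- joining them, and it vanishes when one argument comes from an empty list. Hence `ec` and
  -- `ec-++` can be stated without separating empty lists, and bilinearity collects all edges at one
  -- vertex in a single term.
  link : (X → ℕ) → (X → ℕ) → X → X → ℕ
  link f g a b = f a * g b + f b * g a

  ec : List X → X → X → ℕ
  ec []      a b = 0
  ec (x ∷ l) a b = link (δ x) (hd l) a b + ec l a b

  link-sym : ∀ f g a b → link f g a b ≡ link g f a b
  link-sym f g a b = eq (f a) (f b) (g a) (g b)
    where
    eq : ∀ fa fb ga gb → fa * gb + fb * ga ≡ ga * fb + gb * fa
    eq = solve-∀

  link-+ : ∀ f g h a b → link f (λ v → g v + h v) a b ≡ link f g a b + link f h a b
  link-+ f g h a b = eq (f a) (f b) (g a) (g b) (h a) (h b)
    where
    eq : ∀ fa fb ga gb ha hb →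
      fa * (gb + hb) + fb * (ga + ha) ≡ fa * gb + fb * ga + (fa * hb + fb * ha)
    eq = solve-∀

  link-cong : ∀ {f f′ g g′ : X → ℕ} → (∀ v → f v ≡ f′ v) → (∀ v → g v ≡ g′ v) →
    ∀ a b → link f g a b ≡ link f′ g′ a b
  link-cong p q a b = cong₂ _+_ (cong₂ _*_ (p a) (q b)) (cong₂ _*_ (p b) (q a))

  link-0ʳ : ∀ f a b → link f (λ _ → 0) a b ≡ 0
  link-0ʳ f a b rewrite *-zeroʳ (f a) | *-zeroʳ (f b) = refl

  hd-∷ʳ-++ : ∀ l x r v → hd ((l ∷ʳ x) ++ r) v ≡ hd (l ∷ʳ x) v
  hd-∷ʳ-++ []      x r v = refl
  hd-∷ʳ-++ (_ ∷ _) x r v = refl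

  ls-++-∷ : ∀ l x r v → ls (l ++ x ∷ r) v ≡ ls (x ∷ r) v
  ls-++-∷ []          x r v = refl
  ls-++-∷ (_ ∷ [])    x r v = refl
  ls-++-∷ (_ ∷ y ∷ l) x r v = ls-++-∷ (y ∷ l) x r v

  hd-reverse : ∀ l v → hd (reverse l) v ≡ ls l v
  hd-reverse []          v = refl
  hd-reverse (x ∷ [])    v = refl
  hd-reverse (x ∷ y ∷ l) v = begin
    hd (reverse (x ∷ y ∷ l)) v             ≡⟨ cong (λ z → hd z v) (unfold-reverse x (y ∷ l)) ⟩
    hd (reverse (y ∷ l) ++ x ∷ []) v       ≡⟨ cong (λ z → hd (z ++ x ∷ []) v) (unfold-reverse y l) ⟩
    hd ((reverse l ∷ʳ y) ++ x ∷ []) v      ≡⟨ hd-∷ʳ-++ (reverse l) y (x ∷ []) v ⟩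
    hd (reverse l ∷ʳ y) v                  ≡⟨ cong (λ z → hd z v) (unfold-reverse y l) ⟨
    hd (reverse (y ∷ l)) v                 ≡⟨ hd-reverse (y ∷ l) v ⟩
    ls (y ∷ l) v                           ∎
    where open ≡-Reasoning

  ls-reverse : ∀ l v → ls (reverse l) v ≡ hd l v
  ls-reverse []      v = refl
  ls-reverse (x ∷ l) v rewrite unfold-reverse x l = ls-++-∷ (reverse l) x [] v

  occ-++ : ∀ l r v → occ (l ++ r) v ≡ occ l v + occ r v
  occ-++ l r v = ∑-++ (λ x → δ x v) l r

  occ-reverse : ∀ l v → occ (reverse l) v ≡ occ l v
  occ-reverse []      v = refl
  occ-reverse (x ∷ l) v rewrite unfold-reverse x l | occ-++ (reverse l) (x ∷ []) v | occ-reverse l v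
    = trans (cong (occ l v +_) (+-identityʳ (δ x v))) (+-comm (occ l v) (δ x v))

  ec-++ : ∀ l r a b → ec (l ++ r) a b ≡ ec l a b + link (ls l) (hd r) a b + ec r a b
  ec-++ []          r a b = refl
  ec-++ (x ∷ [])    r a b rewrite link-0ʳ (δ x) a b = refl
  ec-++ (x ∷ y ∷ l) r a b rewrite ec-++ (y ∷ l) r a b =
    eq (link (δ x) (δ y) a b) (link (δ y) (hd l) a b + ec l a b) (link (ls (y ∷ l)) (hd r) a b) (ec r a b)
    where
    eq : ∀ p q r s → p + (q + r + s) ≡ p + q + r + s
    eq = solve-∀

  ec-reverse : ∀ l a b → ec (reverse l) a b ≡ ec l a b
  ec-reverse []      a b = refl
  ec-reverse (x ∷ l) a b
    rewrite unfold-reverse x l | ec-++ (reverse l) (x ∷ []) a b | ec-reverse l a b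
          | link-cong {g = δ x} (ls-reverse l) (λ _ → refl) a b
          | link-0ʳ (δ x) a b | link-sym (hd l) (δ x) a b
    = trans (+-identityʳ _) (+-comm (ec l a b) _)

  hd-δ : ∀ l {x} → 1 ≤ hd l x → ∀ v → hd l v ≡ δ x v
  hd-δ (y ∷ l) p v with δ-pos {y} p
  ... | refl = refl

  ls-δ : ∀ l {x} → 1 ≤ ls l x → ∀ v → ls l v ≡ δ x v
  ls-δ l {x} p v = trans (sym (hd-reverse l v))
    (hd-δ (reverse l) (subst (1 ≤_) (sym (hd-reverse l x)) p) v)

  ls-pos⇒hd-δ : ∀ l {x} → 1 ≤ ls l x → ∃ λ y → ∀ v → hd l v ≡ δ y v
  ls-pos⇒hd-δ (y ∷ l) p = y , λ v → refl

  -- Simplicity is a bound on `occ`, so that it passes through reversing and splicing by equations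
  -- between counts. Adjacency is recovered at the end from the edge counts of the whole family. A
  -- one-vertex sequence is allowed and has two ends at its vertex.
  data Path : List X → Set where
    path : ∀ {x l} → (∀ v → occ (x ∷ l) v ≤ 1) → Path (x ∷ l)

  path-occ : ∀ {p} → Path p → ∀ v → occ p v ≤ 1
  path-occ (path h) = h

  reverse-path : ∀ {p} → Path p → Path (reverse p)
  reverse-path {x ∷ l} (path h) with reverse (x ∷ l) in eq
  ... | []    = ⊥-elim (1+n≢0 (sym (trans (cong (λ z → occ z x) (sym eq)) (trans (occ-reverse (x ∷ l) x) (cong (_+ occ l x) (δ-refl x))))))
  ... | y ∷ r = path λ v → subst (_≤ 1) (sym (trans (cong (λ z → occ z v) (sym eq)) (occ-reverse (x ∷ l) v))) (h v)

-- Adding one edge at a vertex `u`, in the manner of Lovász.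

module Attaching {X : Set} (_≟_ : DecidableEquality X) (u : X) where
  open Counting _≟_

  -- A path through u is cut into two arms, listed from u outwards.  An arm that has already been
  -- rerouted during an augmentation is frozen.
  data Arm : Set where
    live frozen : List X → Arm

  data Item : Set where
    off  : List X → Item
    thru : Arm → Arm → Item

  verts : Arm → List X
  verts (live p)   = p
  verts (frozen p) = p

  toPath : Item → List X
  toPath (off p)    = p
  toPath (thru p q) = reverse (verts p) ++ u ∷ verts q

  -- An empty arm means that the path through `u` ends at `u`.
  emp : List X → ℕ
  emp []      = 1
  emp (_ ∷ _) = 0

  liveHd liveLs : Arm → X → ℕ
  liveHd (live p)   = hd p
  liveHd (frozen p) = λ _ → 0
  liveLs (live p)   = ls p
  liveLs (frozen p) = λ _ → 0

  liveCount : Arm → ℕ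
  liveCount (live _)   = 1
  liveCount (frozen _) = 0

  inner : Item → X → X → ℕ
  inner (off p)    a b = ec p a b
  inner (thru p q) a b = ec (verts p) a b + ec (verts q) a b

  -- Deleting `u` leaves the paths missing `u` and the nonempty arms as pieces. `attached` counts
  -- the piece ends joined to `u`, `allEnds` all piece ends, and `liveFree` the free ends that an
  -- augmentation may still use. Reversing an arm exchanges its attached and its free end and
  -- preserves `inner` and `allEnds`.
  attached liveAttached liveFree allEnds : Item → X → ℕ
  attached     (off p)    v = 0
  attached     (thru p q) v = hd (verts p) v + hd (verts q) v
  liveAttached (off p)    v = 0
  liveAttached (thru p q) v = liveHd p v + liveHd q v
  liveFree     (off p)    v = ends p v
  liveFree     (thru p q) v = liveLs p v + liveLs q v
  allEnds      (off p)    v = ends p v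
  allEnds      (thru p q) v = ends (verts p) v + ends (verts q) v

  endsAtCentre : Item → ℕ
  endsAtCentre (off p)    = 0
  endsAtCentre (thru p q) = emp (verts p) + emp (verts q)

  lives : Item → ℕ
  lives (off p)    = 0
  lives (thru p q) = liveCount p + liveCount q

  data Valid : Item → Set where
    off  : ∀ {p} → Path p → occ p u ≡ 0 → Valid (off p)
    thru : ∀ {p q} → (∀ v → occ (verts p) v + occ (verts q) v + δ u v ≤ 1) → Valid (thru p q)

  liveHd≤hd : ∀ p v → liveHd p v ≤ hd (verts p) v
  liveHd≤hd (live p)   v = ≤-refl
  liveHd≤hd (frozen p) v = z≤n

  liveAttached≤attached : ∀ i v → liveAttached i v ≤ attached i v
  liveAttached≤attached (off p)    v = z≤n
  liveAttached≤attached (thru p q) v = +-mono-≤ (liveHd≤hd p v) (liveHd≤hd q v)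

  emp-reverse : ∀ p {x} → 1 ≤ ls p x → emp (reverse p) ≡ emp p
  emp-reverse p {x} px with reverse p in eq
  emp-reverse (_ ∷ _) {x} px | _ ∷ _ = refl
  emp-reverse (y ∷ p) {x} px | []
    with subst (1 ≤_) (trans (sym (hd-reverse (y ∷ p) x)) (cong (λ z → hd z x) eq)) px
  ... | ()

  -- A free live end at x, up to reversing the path the end belongs to.
  data FreeAt (x : X) : Item → Set where
    whole : ∀ {p p′} → Path p′ → occ p′ u ≡ 0 → (∀ v → hd p′ v ≡ δ x v) →
            (∀ v → ends p′ v ≡ ends p v) → (∀ a b → ec p′ a b ≡ ec p a b) → FreeAt x (off p)
    left  : ∀ {p q} → 1 ≤ ls p x → FreeAt x (thru (live p) q)
    right : ∀ {p q} → 1 ≤ ls p x → FreeAt x (thru q (live p))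

  free-at : ∀ {i x} → Valid i → 1 ≤ liveFree i x → FreeAt x i
  free-at {off p} {x} (off P oc) f with pos-+ {hd p x} f
  ... | inj₁ h = whole P oc (hd-δ p h) (λ v → refl) (λ a b → refl)
  ... | inj₂ l = whole (reverse-path P) (trans (occ-reverse p u) oc)
    (λ v → trans (hd-reverse p v) (ls-δ p l v))
    (λ v → trans (cong₂ _+_ (hd-reverse p v) (ls-reverse p v)) (+-comm (ls p v) (hd p v)))
    (ec-reverse p)
  free-at {thru (live p) (live q)} {x} V f with pos-+ {ls p x} f
  ... | inj₁ h = left h
  ... | inj₂ h = right h
  free-at {thru (live p) (frozen q)} {x} V f = left (subst (1 ≤_) (+-identityʳ _) f)
  free-at {thru (frozen p) (live q)} {x} V f = right f

  -- The pieces left by deleting `u` survive with the same edges and ends; only the choice of the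
  -- ends joined to `u` changes. The last step of the search turns a path missing `u` into one
  -- ending there, which accounts for `centre≡`.
  record Augmented (x : X) (I : List Item) : Set where
    field
      items     : List Item
      valid     : All Valid items
      inner≡    : ∀ a b → ∑ (λ i → inner i a b) items ≡ ∑ (λ i → inner i a b) I
      allEnds≡  : ∀ v → ∑ (λ i → allEnds i v) items ≡ ∑ (λ i → allEnds i v) I
      attached≡ : ∀ v → ∑ (λ i → attached i v) items ≡ ∑ (λ i → attached i v) I + δ x v
      centre≡   : ∑ endsAtCentre items ≡ suc (∑ endsAtCentre I)

  -- Frozen arms offer no free ends: each step freezes one live arm, so the search for an unattached
  -- path ends, and the new centre-neighbour y keeps the free end it had before.
  augment : ∀ k x I → ∑ lives I ≤ k → All Valid I →
    (∀ v → ∑ (λ i → attached i v) I + δ x v ≤ 1) →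
    (∀ v → 1 ≤ ∑ (λ i → liveAttached i v) I + δ x v → 1 ≤ ∑ (λ i → liveFree i v) I) →
    Augmented x I

  -- The arm runs from a neighbour `y` of `u` out to the free end `x`. Reversing it trades the edge
  -- yu for xu, so `y` is the next vertex to be attached; attachments and the pending vertex taken
  -- together are unchanged, which carries the first invariant over. The arm may stand on either
  -- side, as all counts are symmetric in the two arms.
  flip-step : ∀ k x p q R I → I ↭ thru (live p) q ∷ R ⊎ I ↭ thru q (live p) ∷ R →
    1 ≤ ls p x → ∑ lives I ≤ k → All Valid I →
    (∀ v → ∑ (λ i → attached i v) I + δ x v ≤ 1) →
    (∀ v → 1 ≤ ∑ (λ i → liveAttached i v) I + δ x v → 1 ≤ ∑ (λ i → liveFree i v) I) →
    Augmented x I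
  flip-step k x p q R I I↭ lx lk V c₁ c₂ = result k lk
    where
    I′ : List Item
    I′ = thru (frozen (reverse p)) q ∷ R

    y : X
    y = proj₁ (ls-pos⇒hd-δ p lx)

    hd≡ : ∀ v → hd p v ≡ δ y v
    hd≡ = proj₂ (ls-pos⇒hd-δ p lx)

    ls≡ : ∀ v → ls p v ≡ δ x v
    ls≡ = ls-δ p lx

    ∑I : (f : Item → ℕ) → f (thru q (live p)) ≡ f (thru (live p) q) → ∑ f I ≡ f (thru (live p) q) + ∑ f R
    ∑I f e = [ ∑-↭ f , (λ π → trans (∑-↭ f π) (cong (_+ ∑ f R) e)) ] I↭

    V′ : Valid (thru (live p) q) × All Valid R
    V′ = [ (λ π → uncons (All-resp-↭ π V)) , (λ π → swap-arms (uncons (All-resp-↭ π V))) ] I↭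
      where
      swap-arms : Valid (thru q (live p)) × All Valid R → Valid (thru (live p) q) × All Valid R
      swap-arms (thru W , WR) =
        thru (λ v → subst (λ z → z + δ u v ≤ 1) (+-comm (occ (verts q) v) (occ p v)) (W v)) , WR

    VI′ : All Valid I′
    VI′ with V′
    ... | thru W , WR = thru (λ v → subst (λ z → z + occ (verts q) v + δ u v ≤ 1) (sym (occ-reverse p v)) (W v)) ∷ WR

    attI′ : ∀ v → ∑ (λ i → attached i v) I′ + δ y v ≡ ∑ (λ i → attached i v) I + δ x v
    attI′ v rewrite ∑I (λ i → attached i v) (+-comm (hd (verts q) v) (hd p v)) | hd-reverse p v | hd≡ v | ls≡ v =
      eq (δ x v) (hd (verts q) v) (∑ (λ i → attached i v) R) (δ y v)
      where
      eq : ∀ a b c d → a + b + c + d ≡ d + b + c + a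
      eq = solve-∀

    liveAtt : ∀ v → ∑ (λ i → liveAttached i v) I′ + δ y v ≡ ∑ (λ i → liveAttached i v) I
    liveAtt v rewrite ∑I (λ i → liveAttached i v) (+-comm (liveHd q v) (hd p v)) | hd≡ v =
      eq (liveHd q v) (∑ (λ i → liveAttached i v) R) (δ y v)
      where
      eq : ∀ a b c → a + b + c ≡ c + a + b
      eq = solve-∀

    liveFr : ∀ v → ∑ (λ i → liveFree i v) I ≡ δ x v + ∑ (λ i → liveFree i v) I′
    liveFr v rewrite ∑I (λ i → liveFree i v) (+-comm (liveLs q v) (ls p v)) | ls≡ v =
      +-assoc (δ x v) (liveLs q v) _

    c₁′ : ∀ v → ∑ (λ i → attached i v) I′ + δ y v ≤ 1
    c₁′ v = subst (_≤ 1) (sym (attI′ v)) (c₁ v)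

    c₂′ : ∀ v → 1 ≤ ∑ (λ i → liveAttached i v) I′ + δ y v → 1 ≤ ∑ (λ i → liveFree i v) I′
    -- Freezing the arm loses only the free end at `x`. Any other `v` keeps the free end it had, and
    -- `x` makes no demand: otherwise it would have been attached in `I` while pending, against
    -- `c₁`.
    c₂′ v h with positive? (δ x v)
    ... | inj₁ e = subst (1 ≤_) (trans (liveFr v) (cong (_+ _) e))
      (c₂ v (≤-trans (subst (1 ≤_) (liveAtt v) h) (m≤m+n _ _)))
    ... | inj₂ e = ⊥-elim (<⇒≱ (s≤s (≤-trans
      (+-mono-≤ (≤-trans (subst (1 ≤_) (liveAtt v) h) (∑-mono (λ i → liveAttached≤attached i v) I)) e) (c₁ v))) ≤-refl)

    result : ∀ k → ∑ lives I ≤ k → Augmented x I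
    result zero    lk rewrite ∑I lives (+-comm (liveCount q) 1) with lk
    ... | ()
    result (suc k) lk = record
      { items     = A.items
      ; valid     = A.valid
      ; inner≡    = λ a b → trans (A.inner≡ a b) (trans
          (cong (λ z → z + ec (verts q) a b + ∑ (λ i → inner i a b) R) (ec-reverse p a b))
          (sym (∑I (λ i → inner i a b) (+-comm (ec (verts q) a b) (ec p a b)))))
      ; allEnds≡  = λ v → trans (A.allEnds≡ v) (trans
          (cong (λ z → z + ends (verts q) v + ∑ (λ i → allEnds i v) R)
            (trans (cong₂ _+_ (hd-reverse p v) (ls-reverse p v)) (+-comm (ls p v) (hd p v))))
          (sym (∑I (λ i → allEnds i v) (+-comm (ends (verts q) v) (ends p v)))))
      ; attached≡ = λ v → trans (A.attached≡ v) (attI′ v)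
      ; centre≡   = trans A.centre≡ (cong suc (trans
          (cong (λ z → z + emp (verts q) + ∑ endsAtCentre R) (emp-reverse p lx))
          (sym (∑I endsAtCentre (+-comm (emp (verts q)) (emp p))))))
      }
      where
      lk′ : ∑ lives I′ ≤ k
      lk′ with subst (_≤ suc k) (∑I lives (+-comm (liveCount q) 1)) lk
      ... | s≤s le = le
      module A = Augmented (augment k y I′ lk′ VI′ c₁′ c₂′)

  augment k x I lk V c₁ c₂
    with ∑-pick (λ i → liveFree i x) I (c₂ x (subst (λ z → 1 ≤ ∑ (λ i → liveAttached i x) I + z) (sym (δ-refl x)) (m≤n+m 1 _)))
  ... | i , R , π , fx with All-resp-↭ π V
  ...   | Vi ∷ VR with free-at Vi fx
  ...     | left lx  = flip-step k x _ _ R I (inj₁ π) lx lk V c₁ c₂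
  ...     | right lx = flip-step k x _ _ R I (inj₂ π) lx lk V c₁ c₂
  -- A path ending at `x` and missing `u` is extended to `u`. The empty second arm records `u` as
  -- its new end, and the search stops.
  ...     | whole {p} {p′} (path P) oc h≡ e≡ ec≡ = record
    { items     = thru (live p′) (live []) ∷ R
    ; valid     = thru bound ∷ VR
    ; inner≡    = λ a b → trans (cong (_+ ∑ (λ i → inner i a b) R) (trans (+-identityʳ _) (ec≡ a b))) (sym (∑-↭ _ π))
    ; allEnds≡  = λ v → trans (cong (_+ ∑ (λ i → allEnds i v) R) (trans (+-identityʳ _) (e≡ v))) (sym (∑-↭ _ π))
    ; attached≡ = λ v → trans (cong (_+ ∑ (λ i → attached i v) R) (trans (+-identityʳ _) (h≡ v)))
        (trans (+-comm (δ x v) _) (cong (_+ δ x v) (sym (∑-↭ _ π))))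
    ; centre≡   = cong suc (sym (∑-↭ endsAtCentre π))
    }
    where
    bound : ∀ v → occ p′ v + 0 + δ u v ≤ 1
    bound v with positive? (δ u v)
    ... | inj₁ e rewrite e | +-identityʳ (occ p′ v) | +-identityʳ (occ p′ v) = P v
    ... | inj₂ e with δ-pos {u} e
    ...   | refl rewrite oc = δ≤1 u u

  record AllLive (i : Item) : Set where
    field
      attached-live : ∀ v → liveAttached i v ≡ attached i v
      free-live     : ∀ v → liveFree i v + attached i v ≡ allEnds i v

  split-at : ∀ l → 1 ≤ occ l u → ∃₂ λ p q → l ≡ p ++ u ∷ q
  split-at (x ∷ l) h with pos-+ {δ x u} h
  ... | inj₁ e with δ-pos {x} e
  ...   | refl = [] , l , refl
  split-at (x ∷ l) h | inj₂ e with split-at l e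
  ...   | p , q , refl = x ∷ p , q , refl

  toItem : ∀ {l} → Path l → ∃ λ i → toPath i ≡ l × Valid i × AllLive i
  toItem {l} P with positive? (occ l u)
  ... | inj₁ e = off l , refl , off P e , record
    { attached-live = λ v → refl ; free-live = λ v → +-identityʳ _ }
  toItem {l} P | inj₂ h with split-at l h
  ... | p , q , refl = thru (live (reverse p)) (live q) ,
      cong (_++ u ∷ q) (reverse-involutive p) , thru bound , record
      { attached-live = λ v → refl
      ; free-live = λ v → eq (hd (reverse p) v) (ls (reverse p) v) (hd q v) (ls q v) }
    where
    eq : ∀ a b c d → (b + d) + (a + c) ≡ (a + b) + (c + d)
    eq = solve-∀
    rearrange : ∀ a b c → a + b + c ≡ a + (c + b)
    rearrange = solve-∀
    bound : ∀ v → occ (reverse p) v + occ q v + δ u v ≤ 1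
    bound v = subst (_≤ 1) (trans (occ-++ p (u ∷ q) v)
      (trans (sym (rearrange (occ p v) (occ q v) (δ u v)))
             (cong (λ z → z + occ q v + δ u v) (sym (occ-reverse p v))))) (path-occ P v)

  toItems : ∀ {D} → All Path D → ∃ λ I → map toPath I ≡ D × All Valid I × All AllLive I
  toItems []      = [] , refl , [] , []
  toItems (P ∷ Ps) with toItem P | toItems Ps
  ... | i , refl , V , L | I , refl , Vs , Ls = i ∷ I , refl , V ∷ Vs , L ∷ Ls

  toPath-path : ∀ {i} → Valid i → Path (toPath i)
  toPath-path (off P _) = P
  toPath-path {thru p q} (thru V) with reverse (verts p) ++ u ∷ verts q | through
    where
    through : ∀ v → occ (reverse (verts p) ++ u ∷ verts q) v ≡ occ (verts p) v + occ (verts q) v + δ u v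
    through v = trans (occ-++ (reverse (verts p)) (u ∷ verts q) v)
      (trans (cong (_+ (δ u v + occ (verts q) v)) (occ-reverse (verts p) v))
             (rearrange (occ (verts p) v) (occ (verts q) v) (δ u v)))
      where
      rearrange : ∀ a b c → a + (c + b) ≡ a + b + c
      rearrange = solve-∀
  ... | []    | e = ⊥-elim (1+n≢0 (sym (trans (e u) (trans (cong (occ (verts p) u + occ (verts q) u +_) (δ-refl u)) (+-comm _ 1)))))
  ... | x ∷ l | e = path λ v → subst (_≤ 1) (sym (e v)) (V v)

  toPaths-path : ∀ {I} → All Valid I → All Path (map toPath I)
  toPaths-path []       = []
  toPaths-path (V ∷ Vs) = toPath-path V ∷ toPaths-path Vs

  ec-toPath : ∀ i a b → ec (toPath i) a b ≡ inner i a b + link (δ u) (attached i) a b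
  ec-toPath (off p)    a b = sym (trans (cong (ec p a b +_) (link-0ʳ (δ u) a b)) (+-identityʳ _))
  ec-toPath (thru p q) a b
    rewrite ec-++ (reverse (verts p)) (u ∷ verts q) a b | ec-reverse (verts p) a b
          | link-cong {g = δ u} (ls-reverse (verts p)) (λ _ → refl) a b
          | link-sym (hd (verts p)) (δ u) a b
          | link-+ (δ u) (hd (verts p)) (hd (verts q)) a b
    = eq (ec (verts p) a b) (link (δ u) (hd (verts p)) a b) (link (δ u) (hd (verts q)) a b) (ec (verts q) a b)
    where
    eq : ∀ p q r s → p + q + (r + s) ≡ p + s + (q + r)
    eq = solve-∀

  ls-∷ : ∀ p v → ls (u ∷ p) v ≡ ls p v + emp p * δ u v
  ls-∷ []      v = sym (+-identityʳ _)
  ls-∷ (_ ∷ _) v = sym (+-identityʳ _)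

  -- The ends of a path through `u` are the far ends of its nonempty arms, with `u` in place of each
  -- empty arm. The near ends, which `allEnds` also counts, are the attached ones; adding them on
  -- the left avoids subtraction.
  ends-toPath : ∀ i v → ends (toPath i) v + attached i v ≡ allEnds i v + endsAtCentre i * δ u v
  ends-toPath (off p)    v = refl
  ends-toPath (thru p q) v = trans
    (cong₂ (λ y z → y + z + (hd (verts p) v + hd (verts q) v)) hd≡ (trans (ls-++-∷ (reverse (verts p)) u (verts q) v) (ls-∷ (verts q) v)))
    (eq (hd (verts p) v) (hd (verts q) v) (ls (verts p) v) (ls (verts q) v) (emp (verts p)) (emp (verts q)) (δ u v))
    where
    eq : ∀ hp hq lp lq ep eq d →
      (lp + ep * d) + (lq + eq * d) + (hp + hq) ≡ hp + lp + (hq + lq) + (ep + eq) * d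
    eq = solve-∀
    hd-rev : ∀ p r → hd (reverse p ++ u ∷ r) v ≡ ls (u ∷ p) v
    hd-rev p r = begin
      hd (reverse p ++ u ∷ r) v          ≡⟨ cong (λ z → hd z v) (++-assoc (reverse p) (u ∷ []) r) ⟨
      hd ((reverse p ∷ʳ u) ++ r) v       ≡⟨ hd-∷ʳ-++ (reverse p) u r v ⟩
      hd (reverse p ∷ʳ u) v              ≡⟨ cong (λ z → hd z v) (unfold-reverse u p) ⟨
      hd (reverse (u ∷ p)) v             ≡⟨ hd-reverse (u ∷ p) v ⟩
      ls (u ∷ p) v                       ∎
      where open ≡-Reasoning
    hd≡ : hd (reverse (verts p) ++ u ∷ verts q) v ≡ ls (verts p) v + emp (verts p) * δ u v
    hd≡ = trans (hd-rev (verts p) (verts q)) (ls-∷ (verts p) v)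

  ∑-link : ∀ f (I : List Item) (g : Item → X → ℕ) a b →
    ∑ (λ i → link f (g i) a b) I ≡ link f (λ v → ∑ (λ i → g i v) I) a b
  ∑-link f I g a b = trans (∑-+ _ _ I) (cong₂ _+_ (∑-*ˡ (f a) (λ i → g i b) I) (∑-*ˡ (f b) (λ i → g i a) I))

  ec-items : ∀ I a b → ∑ (λ l → ec l a b) (map toPath I) ≡
    ∑ (λ i → inner i a b) I + link (δ u) (λ v → ∑ (λ i → attached i v) I) a b
  ec-items I a b = trans (∑-map _ toPath I) (trans (∑-cong (λ i → ec-toPath i a b) I)
    (trans (∑-+ (λ i → inner i a b) _ I) (cong (∑ (λ i → inner i a b) I +_) (∑-link (δ u) I attached a b))))

  ends-items : ∀ I v → ∑ (λ l → ends l v) (map toPath I) + ∑ (λ i → attached i v) I ≡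
    ∑ (λ i → allEnds i v) I + ∑ endsAtCentre I * δ u v
  ends-items I v = trans (cong (_+ ∑ (λ i → attached i v) I) (∑-map _ toPath I))
    (trans (sym (∑-+ _ (λ i → attached i v) I)) (trans (∑-cong (λ i → ends-toPath i v) I)
    (trans (∑-+ (λ i → allEnds i v) _ I) (cong (∑ (λ i → allEnds i v) I +_)
      (trans (∑-cong (λ i → *-comm (endsAtCentre i) (δ u v)) I)
        (trans (∑-*ˡ (δ u v) endsAtCentre I) (*-comm (δ u v) (∑ endsAtCentre I))))))))

  ∑-All-cong : {A : Set} {R : A → Set} {f g : A → ℕ} → (∀ {x} → R x → f x ≡ g x) → ∀ {l} → All R l → ∑ f l ≡ ∑ g l
  ∑-All-cong eq []       = refl
  ∑-All-cong eq (r ∷ rs) = cong₂ _+_ (eq r) (∑-All-cong eq rs)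

  -- Since there is no loop, `x` and the neighbours of `u` differ from `u`. A path end at such a
  -- vertex is a free end of a piece, so `free` is the condition from which `augment` starts.
  -- Attaching `x` gives the edge ux, and by `ends-items` one path end moves from `x` to `u`.
  add-edge : ∀ x D → All Path D →
    (∀ v → ∑ (λ l → ec l u v) D + δ x v ≤ 1) →
    ∑ (λ l → ec l u u) D + δ x u ≡ 0 →
    (∀ v → 1 ≤ ∑ (λ l → ec l u v) D + δ x v → 1 ≤ ∑ (λ l → ends l v) D) →
    ∃ λ D′ → All Path D′ ×
      (∀ a b → ∑ (λ l → ec l a b) D′ ≡ link (δ u) (δ x) a b + ∑ (λ l → ec l a b) D) ×
      (∀ v → ∑ (λ l → ends l v) D′ + δ x v ≡ ∑ (λ l → ends l v) D + δ u v)
  add-edge x D Ps simple loopless free with toItems Ps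
  ... | I , refl , Vs , Ls = map toPath A.items , toPaths-path A.valid , ec′ , ends′
    where
    att : X → ℕ
    att v = ∑ (λ i → attached i v) I

    att≤ec : ∀ v → att v ≤ ∑ (λ l → ec l u v) (map toPath I)
    att≤ec v = subst (att v ≤_) (sym (ec-items I u v)) (≤-trans
      (subst (_≤ link (δ u) att u v) (trans (cong (_* att v) (δ-refl u)) (*-identityˡ _)) (m≤m+n _ _)) (m≤n+m _ (∑ (λ i → inner i u v) I)))

    liveAtt≡ : ∀ v → ∑ (λ i → liveAttached i v) I ≡ att v
    liveAtt≡ v = ∑-All-cong (λ L → AllLive.attached-live L v) Ls

    liveFree≡ : ∀ v → u ≢ v → ∑ (λ i → liveFree i v) I ≡ ∑ (λ l → ends l v) (map toPath I)
    liveFree≡ v u≢v = +-cancelʳ-≡ (att v) _ _ (trans (sym (∑-+ _ _ I))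
      (trans (∑-All-cong (λ L → AllLive.free-live L v) Ls) (sym (trans (ends-items I v)
        (trans (cong (λ z → ∑ (λ i → allEnds i v) I + ∑ endsAtCentre I * z) (δ-≢ u≢v))
          (trans (cong (∑ (λ i → allEnds i v) I +_) (*-zeroʳ (∑ endsAtCentre I))) (+-identityʳ _)))))))

    c₂ : ∀ v → 1 ≤ ∑ (λ i → liveAttached i v) I + δ x v → 1 ≤ ∑ (λ i → liveFree i v) I
    c₂ v h = subst (1 ≤_) (sym (liveFree≡ v u≢v)) (free v h′)
      where
      h′ : 1 ≤ ∑ (λ l → ec l u v) (map toPath I) + δ x v
      h′ = ≤-trans h (+-monoˡ-≤ (δ x v) (subst (_≤ ∑ (λ l → ec l u v) (map toPath I)) (sym (liveAtt≡ v)) (att≤ec v)))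
      u≢v : u ≢ v
      u≢v refl = <⇒≢ h′ (sym loopless)

    module A = Augmented (augment (∑ lives I) x I ≤-refl Vs
      (λ v → ≤-trans (+-monoˡ-≤ (δ x v) (att≤ec v)) (simple v)) c₂)

    ec′ : ∀ a b → _
    ec′ a b = begin
      ∑ (λ l → ec l a b) (map toPath A.items)
        ≡⟨ ec-items A.items a b ⟩
      ∑ (λ i → inner i a b) A.items + link (δ u) (λ v → ∑ (λ i → attached i v) A.items) a b
        ≡⟨ cong₂ _+_ (A.inner≡ a b) (trans (link-cong {f = δ u} (λ _ → refl) A.attached≡ a b) (link-+ (δ u) att (δ x) a b)) ⟩
      ∑ (λ i → inner i a b) I + (link (δ u) att a b + link (δ u) (δ x) a b)
        ≡⟨ +-assoc (∑ (λ i → inner i a b) I) _ _ ⟨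
      ∑ (λ i → inner i a b) I + link (δ u) att a b + link (δ u) (δ x) a b
        ≡⟨ cong (_+ link (δ u) (δ x) a b) (ec-items I a b) ⟨
      ∑ (λ l → ec l a b) (map toPath I) + link (δ u) (δ x) a b
        ≡⟨ +-comm _ (link (δ u) (δ x) a b) ⟩
      link (δ u) (δ x) a b + ∑ (λ l → ec l a b) (map toPath I) ∎
      where open ≡-Reasoning

    ends′ : ∀ v → _
    ends′ v = +-cancelʳ-≡ (att v) _ _ (begin
      ∑ (λ l → ends l v) (map toPath A.items) + δ x v + att v
        ≡⟨ eq₁ _ (δ x v) (att v) ⟩
      ∑ (λ l → ends l v) (map toPath A.items) + (att v + δ x v)
        ≡⟨ cong (∑ (λ l → ends l v) (map toPath A.items) +_) (A.attached≡ v) ⟨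
      ∑ (λ l → ends l v) (map toPath A.items) + ∑ (λ i → attached i v) A.items
        ≡⟨ ends-items A.items v ⟩
      ∑ (λ i → allEnds i v) A.items + ∑ endsAtCentre A.items * δ u v
        ≡⟨ cong₂ (λ y z → y + z * δ u v) (A.allEnds≡ v) A.centre≡ ⟩
      ∑ (λ i → allEnds i v) I + (δ u v + ∑ endsAtCentre I * δ u v)
        ≡⟨ eq₂ (∑ (λ i → allEnds i v) I) (δ u v) _ ⟩
      ∑ (λ i → allEnds i v) I + ∑ endsAtCentre I * δ u v + δ u v
        ≡⟨ cong (_+ δ u v) (ends-items I v) ⟨
      ∑ (λ l → ends l v) (map toPath I) + att v + δ u v
        ≡⟨ eq₃ _ (att v) (δ u v) ⟩
      ∑ (λ l → ends l v) (map toPath I) + δ u v + att v ∎)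
      where
      open ≡-Reasoning
      eq₁ : ∀ a b c → a + b + c ≡ a + (c + b)
      eq₁ = solve-∀
      eq₂ : ∀ a b c → a + (b + c) ≡ a + c + b
      eq₂ = solve-∀
      eq₃ : ∀ a b c → a + b + c ≡ a + c + b
      eq₃ = solve-∀

-- Path decompositions with a prescribed number of ends at every vertex.

module Decomposing {X : Set} (_≟_ : DecidableEquality X)
                   (vertices : List X) (once : ∀ v → Counting.occ _≟_ vertices v ≡ 1) where
  open Counting _≟_

  ∑-δ : ∀ (f : X → ℕ) v → ∑ (λ w → f w * δ w v) vertices ≡ f v
  ∑-δ f v = trans (∑-cong at-v vertices)
    (trans (∑-*ˡ (f v) (λ w → δ w v) vertices) (trans (cong (f v *_) (once v)) (*-identityʳ _)))
    where
    at-v : ∀ w → f w * δ w v ≡ f v * δ w v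
    at-v w with positive? (δ w v)
    ... | inj₁ e rewrite e = trans (*-zeroʳ (f w)) (sym (*-zeroʳ (f v)))
    ... | inj₂ h rewrite δ-pos {w} h = refl

  -- Multiplicity of the edge between `a` and `b` in the multigraph with edge list `L`, whichever
  -- way round it is listed.
  gc : List (X × X) → X → X → ℕ
  gc L a b = ∑ (λ (x , y) → link (δ x) (δ y) a b) L

  deg : List (X × X) → X → ℕ
  deg L v = ∑ (λ (x , y) → δ x v + δ y v) L

  gc≤deg : ∀ L u v → gc L u v ≤ deg L v
  gc≤deg L u v = ∑-mono (λ (x , y) → subst (_≤ δ x v + δ y v) (+-comm (δ x v * δ y u) _)
    (+-mono-≤ (m*δ≤m (δ x v) y) (subst (_≤ δ y v) (*-comm (δ y v) (δ x u)) (m*δ≤m (δ y v) x)))) L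
    where
    m*δ≤m : ∀ m x → m * δ x u ≤ m
    m*δ≤m m x = subst (m * δ x u ≤_) (*-identityʳ m) (*-monoʳ-≤ m (δ≤1 x u))

  Decomposition : (X → X → ℕ) → (X → ℕ) → Set
  Decomposition E t = ∃ λ D → All Path D ×
    (∀ a b → ∑ (λ l → ec l a b) D ≡ E a b) × (∀ v → ∑ (λ l → ends l v) D ≡ t v)

  -- Without edges, an even demand `t v` is met by half as many copies of the one-vertex path at
  -- `v`, each of which has both ends there.
  trivial-paths : ∀ t → (∀ v → 2 ∣ t v) → Decomposition (λ _ _ → 0) t
  trivial-paths t even = concatMap trivial vertices
    , All.concat⁺ (All.map⁺ (universal (λ w → All.replicate⁺ (half w) (path λ v → subst (_≤ 1) (sym (+-identityʳ _)) (δ≤1 w v))) vertices))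
    , (λ a b → trans (∑-concatMap _ trivial vertices)
        (trans (∑-cong (λ w → trans (∑-replicate _ (half w) (w ∷ [])) (trans (cong (λ z → half w * (z + 0)) (link-0ʳ (δ w) a b)) (*-zeroʳ (half w)))) vertices) (∑-0 vertices)))
    , (λ v → trans (∑-concatMap _ trivial vertices)
        (trans (∑-cong (λ w → trans (∑-replicate _ (half w) (w ∷ [])) (twice w v)) vertices) (∑-δ t v)))
    where
    half : X → ℕ
    half v = _∣_.quotient (even v)
    trivial : X → List (List X)
    trivial w = replicate (half w) (w ∷ [])
    ∑-replicate : {A : Set} (f : A → ℕ) (k : ℕ) (x : A) → ∑ f (replicate k x) ≡ k * f x
    ∑-replicate f zero    x = refl
    ∑-replicate f (suc k) x = cong (f x +_) (∑-replicate f k x)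
    eq : ∀ h d → h * (d + d) ≡ h * 2 * d
    eq = solve-∀
    twice : ∀ w v → half w * (δ w v + δ w v) ≡ t w * δ w v
    twice w v = trans (eq (half w) (δ w v)) (cong (_* δ w v) (sym (_∣_.equality (even w))))

  -- Induction on the edges: every non-isolated vertex except possibly one (the hole) must keep a
  -- path end.  Removing an edge xu at the hole x makes u the only possible hole.
  decompose : ∀ k L t h → length L ≤ k →
    (∀ a b → gc L a b ≤ 1) → (∀ a → gc L a a ≡ 0) → (∀ v → 2 ∣ t v + deg L v) →
    (∀ v → v ≢ h → 1 ≤ deg L v → 1 ≤ t v) → Decomposition (gc L) t

  -- As `u` is not the hole, it has an end to give up: the rest is decomposed with one end less at
  -- `u` and one more at `x`, and `add-edge` moves that end back. Now `x` and the remaining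
  -- neighbours of `u` are supplied and only `u` may lack an end, so `u` is the new hole. Demand
  -- plus degree drops by two at `u` and stays the same elsewhere, which keeps its parity.
  remove-edge : ∀ k L t x u L′ → L ↭ (x , u) ∷ L′ ⊎ L ↭ (u , x) ∷ L′ → length L ≤ suc k →
    (∀ a b → gc L a b ≤ 1) → (∀ a → gc L a a ≡ 0) → (∀ v → 2 ∣ t v + deg L v) →
    (∀ v → v ≢ x → 1 ≤ deg L v → 1 ≤ t v) → Decomposition (gc L) t
  remove-edge k L t x u L′ L↭ len simple loopless even hole =
    let D  , Ps  , ec≡  , ends≡  = rec
        D′ , Ps′ , ec≡′ , ends≡′ = Attaching.add-edge _≟_ u x D Ps
          (λ v → subst (λ z → z + δ x v ≤ 1) (sym (ec≡ u v)) (≤-trans (gc′+δ≤gc v) (simple u v)))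
          (n≤0⇒n≡0 (subst (λ z → z + δ x u ≤ 0) (sym (ec≡ u u)) (subst (gc L′ u u + δ x u ≤_) (loopless u) (gc′+δ≤gc u))))
          (λ v p → subst (1 ≤_) (sym (ends≡ v)) (free v (subst (λ z → 1 ≤ z + δ x v) (ec≡ u v) p)))
    in D′ , Ps′
      , (λ a b → trans (ec≡′ a b) (trans (cong (link (δ u) (δ x) a b +_) (ec≡ a b)) (sym (gc≡ a b))))
      , (λ v → +-cancelʳ-≡ (δ x v) _ _ (trans (ends≡′ v) (trans (cong (_+ δ u v) (ends≡ v)) (t′≡ v))))
    where
    len′ : length L′ ≤ k
    len′ = ≤-pred (subst (_≤ suc k) ([ ↭-length , ↭-length ] L↭) len)

    gc≡ : ∀ a b → gc L a b ≡ link (δ u) (δ x) a b + gc L′ a b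
    gc≡ a b = [ (λ π → trans (∑-↭ _ π) (cong (_+ gc L′ a b) (link-sym (δ x) (δ u) a b))) , ∑-↭ _ ] L↭

    deg≡ : ∀ v → deg L v ≡ δ u v + δ x v + deg L′ v
    deg≡ v = [ (λ π → trans (∑-↭ _ π) (cong (_+ deg L′ v) (+-comm (δ x v) (δ u v)))) , ∑-↭ _ ] L↭

    u≢x : u ≢ x
    u≢x refl = 1+n≢0 (n≤0⇒n≡0 (subst (1 ≤_) (loopless u) (subst (1 ≤_) (sym (gc≡ u u))
      (subst (λ z → 1 ≤ z * z + z * z + gc L′ u u) (sym (δ-refl u)) (s≤s z≤n)))))

    tu : 1 ≤ t u
    tu = hole u u≢x (subst (1 ≤_) (sym (deg≡ u))
      (subst (λ z → 1 ≤ z + δ x u + deg L′ u) (sym (δ-refl u)) (s≤s z≤n)))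

    t′ : X → ℕ
    t′ v = t v + δ x v ∸ δ u v

    δ≤t : ∀ v → δ u v ≤ t v + δ x v
    δ≤t v with positive? (δ u v)
    ... | inj₁ e = subst (_≤ t v + δ x v) (sym e) z≤n
    ... | inj₂ p with δ-pos {u} p
    ...   | refl = ≤-trans (δ≤1 u u) (≤-trans tu (m≤m+n _ _))

    t′≡ : ∀ v → t′ v + δ u v ≡ t v + δ x v
    t′≡ v = m∸n+n≡m (δ≤t v)

    even′ : ∀ v → 2 ∣ t′ v + deg L′ v
    even′ v = ∣m+n∣m⇒∣n (subst (2 ∣_) (begin
      t v + deg L v                              ≡⟨ cong (t v +_) (deg≡ v) ⟩
      t v + (δ u v + δ x v + deg L′ v)           ≡⟨ eq₁ (t v) (δ u v) (δ x v) (deg L′ v) ⟩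
      t v + δ x v + (δ u v + deg L′ v)           ≡⟨ cong (_+ (δ u v + deg L′ v)) (t′≡ v) ⟨
      t′ v + δ u v + (δ u v + deg L′ v)          ≡⟨ eq₂ (t′ v) (δ u v) (deg L′ v) ⟩
      2 * δ u v + (t′ v + deg L′ v)              ∎) (even v)) (m∣m*n (δ u v))
      where
      open ≡-Reasoning
      eq₁ : ∀ a b c d → a + (b + c + d) ≡ a + c + (b + d)
      eq₁ = solve-∀
      eq₂ : ∀ a b c → a + b + (b + c) ≡ 2 * b + (a + c)
      eq₂ = solve-∀

    t′-off : ∀ v → v ≢ u → t′ v ≡ t v + δ x v
    t′-off v ne = cong (t v + δ x v ∸_) (δ-≢ (λ e → ne (sym e)))

    hole′ : ∀ v → v ≢ u → 1 ≤ deg L′ v → 1 ≤ t′ v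
    hole′ v ne p with positive? (δ x v)
    ... | inj₂ q = subst (1 ≤_) (sym (t′-off v ne)) (≤-trans q (m≤n+m _ _))
    ... | inj₁ q = subst (1 ≤_) (sym (t′-off v ne)) (≤-trans
      (hole v (λ { refl → 1+n≢0 (trans (sym (δ-refl x)) q) })
        (subst (1 ≤_) (sym (deg≡ v)) (≤-trans p (m≤n+m _ _)))) (m≤m+n _ _))

    gc′≤gc : ∀ a b → gc L′ a b ≤ gc L a b
    gc′≤gc a b = subst (gc L′ a b ≤_) (sym (gc≡ a b)) (m≤n+m _ _)

    gc′+δ≤gc : ∀ v → gc L′ u v + δ x v ≤ gc L u v
    gc′+δ≤gc v = subst₂ _≤_ (+-comm (δ x v) _) (sym (gc≡ u v)) (+-monoˡ-≤ (gc L′ u v)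
      (subst (_≤ link (δ u) (δ x) u v) (trans (cong (_* δ x v) (δ-refl u)) (*-identityˡ _)) (m≤m+n _ _)))

    free : ∀ v → 1 ≤ gc L′ u v + δ x v → 1 ≤ t′ v
    free v p with pos-+ {gc L′ u v} p
    ... | inj₁ q = hole′ v v≢u (≤-trans q (gc≤deg L′ u v))
      where
      v≢u : v ≢ u
      v≢u refl = <⇒≢ (≤-trans p (gc′+δ≤gc u)) (sym (loopless u))
    ... | inj₂ q = subst (1 ≤_) (sym (t′-off v v≢u)) (≤-trans q (m≤n+m _ _))
      where
      v≢u : v ≢ u
      v≢u refl = <⇒≢ (≤-trans p (gc′+δ≤gc u)) (sym (loopless u))

    rec : Decomposition (gc L′) t′
    rec = decompose k L′ t′ u len′ (λ a b → ≤-trans (gc′≤gc a b) (simple a b))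
      (λ a → n≤0⇒n≡0 (subst (gc L′ a a ≤_) (loopless a) (gc′≤gc a a))) even′ hole′

  decompose k [] t h len simple loopless even hole =
    trivial-paths t (λ v → subst (2 ∣_) (+-identityʳ _) (even v))
  -- If the hole has no path end but has an edge, an edge at the hole is removed. Otherwise the
  -- condition holds at the hole as well, and the first edge serves.
  decompose (suc k) L@((x , u) ∷ L′) t h len simple loopless even hole
    with positive? (t h) | positive? (deg L h)
  ... | inj₂ th | _ = remove-edge k L t x u L′ (inj₁ ↭-refl) len simple loopless even no-hole
    where
    no-hole : ∀ v → v ≢ x → 1 ≤ deg L v → 1 ≤ t v
    no-hole v _ p with v ≟ h
    ... | yes refl = th
    ... | no v≢h   = hole v v≢h p
  ... | inj₁ _ | inj₁ dh = remove-edge k L t x u L′ (inj₁ ↭-refl) len simple loopless even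
    (λ v _ p → hole v (λ { refl → 1+n≢0 (n≤0⇒n≡0 (subst (1 ≤_) dh p)) }) p)
  ... | inj₁ _ | inj₂ dh with ∑-pick _ L dh
  ...   | (a , b) , R , π , p with pos-+ {δ a h} p
  ...     | inj₁ q with δ-pos {a} q
  ...       | refl = remove-edge k L t a b R (inj₁ π) len simple loopless even hole
  decompose (suc k) L@(_ ∷ _) t h len simple loopless even hole
      | inj₁ _ | inj₂ dh | (a , b) , R , π , p | inj₂ q with δ-pos {b} q
  ...       | refl = remove-edge k L t b a R (inj₂ π) len simple loopless even hole

-- Orienting paths so that each vertex starts at most one and finishes at most one.

module Orienting {X : Set} (_≟_ : DecidableEquality X) where
  open Counting _≟_

  -- Consecutive paths, each starting where the previous one ends; J counts the junctions.
  record Chain : Set where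
    field
      links : List (List X)
      good  : All Path links
      s e   : X
      J     : X → ℕ
      heads : ∀ v → ∑ (λ p → hd p v) links ≡ J v + δ s v
      lasts : ∀ v → ∑ (λ p → ls p v) links ≡ J v + δ e v

  open Chain

  weight : Chain → X → ℕ
  weight c v = ∑ (λ p → ends p v) (links c)

  edges : Chain → X → X → ℕ
  edges c a b = ∑ (λ p → ec p a b) (links c)

  weight≡ : ∀ c v → weight c v ≡ J c v + δ (s c) v + (J c v + δ (e c) v)
  weight≡ c v = trans (∑-+ _ _ (links c)) (cong₂ _+_ (heads c v) (lasts c v))

  flip : ∀ c → ∃ λ d → s d ≡ e c × e d ≡ s c × (∀ v → weight d v ≡ weight c v) × (∀ a b → edges d a b ≡ edges c a b)
  flip c = record
    { links = map reverse (links c)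
    ; good  = reverse-all (good c)
    ; s = e c ; e = s c ; J = J c
    ; heads = λ v → trans (∑-rev (λ p → hd p v) (λ p → ls p v) (λ p → hd-reverse p v)) (lasts c v)
    ; lasts = λ v → trans (∑-rev (λ p → ls p v) (λ p → hd p v) (λ p → ls-reverse p v)) (heads c v)
    } , refl , refl
    , (λ v → ∑-rev (λ p → ends p v) (λ p → ends p v) (λ p → trans (cong₂ _+_ (hd-reverse p v) (ls-reverse p v)) (+-comm (ls p v) (hd p v))))
    , (λ a b → ∑-rev (λ p → ec p a b) (λ p → ec p a b) (λ p → ec-reverse p a b))
    where
    reverse-all : ∀ {l} → All Path l → All Path (map reverse l)
    reverse-all []       = []
    reverse-all (P ∷ Ps) = reverse-path P ∷ reverse-all Ps
    ∑-rev : (f g : List X → ℕ) → (∀ p → f (reverse p) ≡ g p) → ∑ f (map reverse (links c)) ≡ ∑ g (links c)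
    ∑-rev f g fg = trans (∑-map f reverse (links c)) (∑-cong fg (links c))

  join : ∀ c d → e c ≡ s d → Chain
  join c d ec≡sd = record
    { links = links c ++ links d
    ; good  = All.++⁺ (good c) (good d)
    ; s = s c ; e = e d ; J = λ v → J c v + J d v + δ (e c) v
    ; heads = λ v → trans (∑-++ _ (links c) (links d)) (trans (cong₂ _+_ (heads c v) (heads d v))
        (trans (cong (λ z → J c v + δ (s c) v + (J d v + δ z v)) (sym ec≡sd)) (eq₁ (J c v) (δ (s c) v) (J d v) (δ (e c) v))))
    ; lasts = λ v → trans (∑-++ _ (links c) (links d)) (trans (cong₂ _+_ (lasts c v) (lasts d v))
        (eq₂ (J c v) (δ (e c) v) (J d v) (δ (e d) v)))
    }
    where
    eq₁ : ∀ a b c d → a + b + (c + d) ≡ a + c + d + b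
    eq₁ = solve-∀
    eq₂ : ∀ a b c d → a + b + (c + d) ≡ a + c + b + d
    eq₂ = solve-∀

  -- A junction has weight at least two, one for the path finishing and one for the path starting
  -- there. A vertex of weight one is therefore an extreme of the chain.
  end-at : ∀ d v → 1 ≤ weight d v → weight d v ≤ 1 → s d ≡ v ⊎ e d ≡ v
  end-at d v p q with positive? (J d v)
  ... | inj₂ j = ⊥-elim (<⇒≱ (s≤s (≤-trans (+-mono-≤ (≤-trans j (m≤m+n _ (δ (s d) v))) (≤-trans j (m≤m+n _ (δ (e d) v))))
      (subst (_≤ 1) (weight≡ d v) q))) ≤-refl)
  ... | inj₁ j with pos-+ {δ (s d) v} (subst (1 ≤_) (trans (weight≡ d v) (cong (λ z → z + δ (s d) v + (z + δ (e d) v)) j)) p)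
  ...   | inj₁ h = inj₁ (δ-pos h)
  ...   | inj₂ h = inj₂ (δ-pos h)

  start-at : ∀ d v → 1 ≤ weight d v → weight d v ≤ 1 →
    ∃ λ d′ → v ≡ s d′ × (∀ w → weight d′ w ≡ weight d w) × (∀ a b → edges d′ a b ≡ edges d a b)
  start-at d v p q with end-at d v p q
  ... | inj₁ h = d , sym h , (λ _ → refl) , (λ _ _ → refl)
  ... | inj₂ h with flip d
  ...   | d′ , s≡ , _ , w≡ , e≡ = d′ , trans (sym h) (sym s≡) , w≡ , e≡

  ends-pos : ∀ c → 1 ≤ weight c (s c) × 1 ≤ weight c (e c)
  ends-pos c = subst (1 ≤_) (sym (weight≡ c (s c))) (subst (λ z → 1 ≤ J c (s c) + z + (J c (s c) + δ (e c) (s c))) (sym (δ-refl (s c)))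
                 (≤-trans (m≤n+m 1 (J c (s c))) (m≤m+n _ _)))
             , subst (1 ≤_) (sym (weight≡ c (e c))) (subst (λ z → 1 ≤ J c (e c) + δ (s c) (e c) + (J c (e c) + z)) (sym (δ-refl (e c)))
                 (≤-trans (m≤n+m 1 (J c (e c))) (m≤n+m _ (J c (e c) + δ (s c) (e c)))))

  record Oriented (Cs : List Chain) : Set where
    field
      paths  : List (List X)
      good   : All Path paths
      edges≡ : ∀ a b → ∑ (λ p → ec p a b) paths ≡ ∑ (λ c → edges c a b) Cs
      ends≡  : ∀ v → ∑ (λ p → ends p v) paths ≡ ∑ (λ c → weight c v) Cs
      hd≤1   : ∀ v → ∑ (λ p → hd p v) paths ≤ 1
      ls≤1   : ∀ v → ∑ (λ p → ls p v) paths ≤ 1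

  -- Chains sharing an end vertex are merged; a chain that meets no other one can be oriented freely.
  orient : ∀ k Cs → length Cs ≤ k → (∀ v → ∑ (λ c → weight c v) Cs ≤ 2) → Oriented Cs

  -- The total weight at `e c` is at most two and `c` already uses one, so a chain meeting `c` there
  -- has weight exactly one and, by `start-at`, can be turned to begin at `e c`. Joining the two
  -- keeps all weights and shortens the list of chains.
  merge : ∀ k c Cs → suc (length Cs) ≤ suc k → (∀ v → weight c v + ∑ (λ d → weight d v) Cs ≤ 2) →
    1 ≤ ∑ (λ d → weight d (e c)) Cs → Oriented (c ∷ Cs)
  merge k c Cs len bound meets with ∑-pick (λ d → weight d (e c)) Cs meets
  ... | d , R , π , p with start-at d (e c) p
        (≤-trans (m≤m+n _ _) (≤-pred (≤-trans (+-monoˡ-≤ (weight d (e c) + ∑ (λ i → weight i (e c)) R) (proj₂ (ends-pos c)))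
          (subst (λ z → weight c (e c) + z ≤ 2) (∑-↭ _ π) (bound (e c))))))
  ...   | d′ , e≡s , w≡ , ed≡ = finish k len
    where
    c+d : Chain
    c+d = join c d′ e≡s

    weights : ∀ v → ∑ (λ i → weight i v) (c+d ∷ R) ≡ ∑ (λ i → weight i v) (c ∷ Cs)
    weights v = trans (cong (_+ ∑ (λ i → weight i v) R) (trans (∑-++ _ (links c) (links d′)) (cong (weight c v +_) (w≡ v))))
      (trans (+-assoc (weight c v) (weight d v) _) (cong (weight c v +_) (sym (∑-↭ _ π))))

    alledges : ∀ a b → ∑ (λ i → edges i a b) (c+d ∷ R) ≡ ∑ (λ i → edges i a b) (c ∷ Cs)
    alledges a b = trans (cong (_+ ∑ (λ i → edges i a b) R) (trans (∑-++ _ (links c) (links d′)) (cong (edges c a b +_) (ed≡ a b))))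
      (trans (+-assoc (edges c a b) (edges d a b) _) (cong (edges c a b +_) (sym (∑-↭ _ π))))

    finish : ∀ k → suc (length Cs) ≤ suc k → Oriented (c ∷ Cs)
    finish k len = record
      { paths = O.paths ; good = O.good ; hd≤1 = O.hd≤1 ; ls≤1 = O.ls≤1
      ; edges≡ = λ a b → trans (O.edges≡ a b) (alledges a b)
      ; ends≡  = λ v → trans (O.ends≡ v) (weights v) }
      where module O = Oriented (orient k (c+d ∷ R)
              (≤-trans (≤-reflexive (sym (↭-length π))) (≤-pred len)) (λ v → subst (_≤ 2) (sym (weights v)) (bound v)))

  orient k [] len bound = record
    { paths = [] ; good = [] ; edges≡ = λ _ _ → refl ; ends≡ = λ _ → refl ; hd≤1 = λ _ → z≤n ; ls≤1 = λ _ → z≤n }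
  orient (suc k) (c ∷ Cs) len bound with positive? (∑ (λ d → weight d (e c)) Cs) | positive? (∑ (λ d → weight d (s c)) Cs)
  ... | inj₂ m | _      = merge k c Cs len bound m
  ... | inj₁ _ | inj₂ m with flip c
  ...   | c′ , _ , e≡ , w≡ , ed≡ = record
    { paths = O.paths ; good = O.good ; hd≤1 = O.hd≤1 ; ls≤1 = O.ls≤1
    ; edges≡ = λ a b → trans (O.edges≡ a b) (cong (_+ ∑ (λ i → edges i a b) Cs) (ed≡ a b))
    ; ends≡  = λ v → trans (O.ends≡ v) (cong (_+ ∑ (λ i → weight i v) Cs) (w≡ v)) }
    where module O = Oriented (merge k c′ Cs len (λ v → subst (λ z → z + ∑ (λ d → weight d v) Cs ≤ 2) (sym (w≡ v)) (bound v))
                                 (subst (λ z → 1 ≤ ∑ (λ d → weight d z) Cs) (sym e≡) m))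
  -- No other chain has a path end at an extreme of `c`, so the direction of `c` can stand.
  orient (suc k) (c ∷ Cs) len bound | inj₁ e-free | inj₁ s-free = record
    { paths  = links c ++ O.paths
    ; good   = All.++⁺ (good c) O.good
    ; edges≡ = λ a b → trans (∑-++ _ (links c) O.paths) (cong (edges c a b +_) (O.edges≡ a b))
    ; ends≡  = λ v → trans (∑-++ _ (links c) O.paths) (cong (weight c v +_) (O.ends≡ v))
    ; hd≤1   = λ v → subst (_≤ 1) (sym (∑-++ _ (links c) O.paths))
        (separate v (λ p → hd p v) (s c) s-free (heads c v) (λ p → m≤m+n _ _) (O.hd≤1 v) (J+hd v))
    ; ls≤1   = λ v → subst (_≤ 1) (sym (∑-++ _ (links c) O.paths))
        (separate v (λ p → ls p v) (e c) e-free (lasts c v) (λ p → m≤n+m _ _) (O.ls≤1 v) (J+ls v))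
    }
    where
    module O = Oriented (orient k Cs (≤-pred len) (λ v → ≤-trans (m≤n+m _ _) (bound v)))

    J+hd : ∀ v → J c v + ∑ (λ p → hd p v) (links c) ≤ weight c v
    J+hd v = subst₂ _≤_ (+-comm _ (J c v)) (sym (∑-+ _ _ (links c)))
      (+-monoʳ-≤ (∑ (λ p → hd p v) (links c)) (subst (J c v ≤_) (sym (lasts c v)) (m≤m+n _ _)))

    J+ls : ∀ v → J c v + ∑ (λ p → ls p v) (links c) ≤ weight c v
    J+ls v = subst (J c v + ∑ (λ p → ls p v) (links c) ≤_) (sym (∑-+ _ _ (links c)))
      (+-monoˡ-≤ (∑ (λ p → ls p v) (links c)) (subst (J c v ≤_) (sym (heads c v)) (m≤m+n _ _)))

    -- At a junction the weight of `c` exceeds what `f` counts on `c` by at least one, so the total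
    -- of two leaves room for one in all. Elsewhere `c` contributes only at its extreme `x`, and
    -- there the other chains contribute nothing.
    separate : ∀ v (f : List X → ℕ) x → ∑ (λ d → weight d x) Cs ≡ 0 →
      ∑ f (links c) ≡ J c v + δ x v → (∀ p → f p ≤ ends p v) → ∑ f O.paths ≤ 1 →
      J c v + ∑ f (links c) ≤ weight c v → ∑ f (links c) + ∑ f O.paths ≤ 1
    separate v f x free f≡ f≤ O≤1 J+f with positive? (J c v) | positive? (δ x v)
    ... | inj₁ j | inj₁ d rewrite f≡ | j | d = O≤1
    ... | inj₁ j | inj₂ d with δ-pos {x} d
    ...   | refl rewrite f≡ | j = subst (λ z → δ x x + z ≤ 1) (sym none) (subst (_≤ 1) (sym (+-identityʳ _)) (δ≤1 x x))
      where
      none : ∑ f O.paths ≡ 0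
      none = n≤0⇒n≡0 (≤-trans (∑-mono f≤ O.paths) (≤-reflexive (trans (O.ends≡ x) free)))
    separate v f x free f≡ f≤ O≤1 J+f | inj₂ j | _ = ≤-trans
      (+-monoʳ-≤ (∑ f (links c)) (≤-trans (∑-mono f≤ O.paths) (≤-reflexive (O.ends≡ v))))
      (≤-pred (≤-trans (+-monoˡ-≤ (∑ (λ d → weight d v) Cs) (≤-trans (+-monoˡ-≤ (∑ f (links c)) j) J+f)) (bound v)))

-- One path starting at each vertex.

module Rooting {X : Set} (_≟_ : DecidableEquality X)
               (vertices : List X) (once : ∀ v → Counting.occ _≟_ vertices v ≡ 1) where
  open Counting _≟_
  open Decomposing _≟_ vertices once

  -- The empty default gives the one-vertex path to a vertex at which no path of `D` starts.
  root : List (List X) → X → List X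
  root []            v = []
  root ([] ∷ D)      v = root D v
  root ((x ∷ l) ∷ D) v = if does (x ≟ v) then l else root D v

  root-none : ∀ D v → ∑ (λ p → hd p v) D ≡ 0 → root D v ≡ []
  root-none []            v e = refl
  root-none ([] ∷ D)      v e = root-none D v e
  root-none ((x ∷ l) ∷ D) v e with x ≟ v
  ... | no _ = root-none D v e

  root-path : ∀ D → All Path D → ∀ v → Path (v ∷ root D v)
  root-path []            _        v = path λ w → subst (_≤ 1) (sym (+-identityʳ _)) (δ≤1 v w)
  root-path ((x ∷ l) ∷ D) (P ∷ Ps) v with x ≟ v
  ... | yes refl = P
  ... | no _     = root-path D Ps v

  -- Compared with `D`, the rooted family gains one-vertex paths exactly at the vertices where no
  -- path of `D` starts. To avoid subtraction, the one-vertex paths `take 1 p` at the starts are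
  -- added on the left and those at all vertices on the right.
  ∑-root : ∀ (f : List X → ℕ) D → All Path D → (∀ v → ∑ (λ p → hd p v) D ≤ 1) →
    ∑ (λ v → f (v ∷ root D v)) vertices + ∑ (λ p → f (take 1 p)) D ≡
    ∑ f D + ∑ (λ v → f (v ∷ [])) vertices
  ∑-root f [] _ _ = +-identityʳ _
  ∑-root f ((x ∷ l) ∷ D) (_ ∷ Ps) hd≤1 = +-cancelʳ-≡ S _ _ (begin
    g′ + (f (x ∷ []) + T) + S   ≡⟨ eq₁ g′ (f (x ∷ [])) T S ⟩
    (g′ + f (x ∷ [])) + T + S   ≡⟨ cong (λ z → z + T + S) update ⟩
    g + f (x ∷ l) + T + S       ≡⟨ eq₂ g (f (x ∷ l)) T S ⟩
    f (x ∷ l) + (g + T) + S     ≡⟨ cong (λ z → f (x ∷ l) + z + S) (∑-root f D Ps (λ v → ≤-trans (m≤n+m _ _) (hd≤1 v))) ⟩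
    f (x ∷ l) + (∑ f D + S) + S ≡⟨ cong (_+ S) (+-assoc (f (x ∷ l)) (∑ f D) S) ⟨
    f (x ∷ l) + ∑ f D + S + S   ∎)
    where
    open ≡-Reasoning
    g g′ S T : ℕ
    g  = ∑ (λ v → f (v ∷ root D v)) vertices
    g′ = ∑ (λ v → f (v ∷ root ((x ∷ l) ∷ D) v)) vertices
    S  = ∑ (λ v → f (v ∷ [])) vertices
    T  = ∑ (λ p → f (take 1 p)) D
    eq₁ : ∀ a b c d → a + (b + c) + d ≡ a + b + c + d
    eq₁ = solve-∀
    eq₂ : ∀ a b c d → a + b + c + d ≡ b + (a + c) + d
    eq₂ = solve-∀
    -- No path of `D` starts at `x`, so putting in `x ∷ l` replaces a one-vertex path and alters
    -- nothing else.
    D-none : root D x ≡ []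
    D-none = root-none D x (n≤0⇒n≡0 (≤-pred (subst (λ z → z + ∑ (λ p → hd p x) D ≤ 1) (δ-refl x) (hd≤1 x))))
    pointwise : ∀ v → f (v ∷ root ((x ∷ l) ∷ D) v) + f (x ∷ []) * δ v x ≡ f (v ∷ root D v) + f (x ∷ l) * δ v x
    pointwise v with x ≟ v
    ... | yes refl rewrite D-none | δ-refl x = eq (f (x ∷ l)) (f (x ∷ []))
      where
      eq : ∀ a b → a + b * 1 ≡ b + a * 1
      eq = solve-∀
    ... | no x≢v rewrite δ-≢ (λ e → x≢v (sym e)) | *-zeroʳ (f (x ∷ [])) | *-zeroʳ (f (x ∷ l)) = refl
    update : g′ + f (x ∷ []) ≡ g + f (x ∷ l)
    update = trans (cong (g′ +_) (sym (∑-δ (λ _ → f (x ∷ [])) x))) (trans (sym (∑-+ _ _ vertices))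
      (trans (∑-cong pointwise vertices) (trans (∑-+ _ _ vertices) (cong (g +_) (∑-δ (λ _ → f (x ∷ l)) x)))))

  -- The path A v is `v ∷ tail v`. The bound `fibre≤` is what limits how many paths stop in an inner
  -- layer.
  record Rooted (E : X → X → ℕ) : Set where
    field
      tail   : X → List X
      path-v : ∀ v → Path (v ∷ tail v)
      edges≡ : ∀ a b → ∑ (λ v → ec (v ∷ tail v) a b) vertices ≡ E a b
      fibre≤ : ∀ w → ∑ (λ v → ls (v ∷ tail v) w) vertices ≤ 2

  -- The number of path ends wanted at a vertex, as a function of its degree: 1 or 2, with the
  -- parity of the degree. Positivity leaves no hole at the start, and the bound of two is what
  -- `orient` asks for.
  target : ℕ → ℕ
  target 0             = 2
  target 1             = 1
  target (suc (suc d)) = target d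

  1≤target : ∀ d → 1 ≤ target d
  1≤target 0             = s≤s z≤n
  1≤target 1             = s≤s z≤n
  1≤target (suc (suc d)) = 1≤target d

  target≤2 : ∀ d → target d ≤ 2
  target≤2 0             = ≤-refl
  target≤2 1             = s≤s z≤n
  target≤2 (suc (suc d)) = target≤2 d

  target-parity : ∀ d → 2 ∣ target d + d
  target-parity 0             = divides 1 refl
  target-parity 1             = divides 1 refl
  target-parity (suc (suc d)) with target-parity d
  ... | divides q e = divides (suc q) (trans (+-suc (target d) (suc d)) (cong suc (trans (+-suc (target d) d) (cong suc e))))

  open Orienting _≟_

  chains : ∀ {D} → All Path D → ∃ λ Cs →
    (∀ a b → ∑ (λ c → edges c a b) Cs ≡ ∑ (λ p → ec p a b) D) × (∀ v → ∑ (λ c → weight c v) Cs ≡ ∑ (λ p → ends p v) D)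
  chains [] = [] , (λ _ _ → refl) , (λ _ → refl)
  chains (P@(path {x} {l} _) ∷ Ps) with chains Ps
  ... | Cs , e , w = single x l P ∷ Cs , (λ a b → cong₂ _+_ (+-identityʳ _) (e a b)) , (λ v → cong₂ _+_ (+-identityʳ _) (w v))
    where
    last : X → List X → X
    last x []      = x
    last x (y ∷ l) = last y l
    ls-last : ∀ x l v → ls (x ∷ l) v ≡ δ (last x l) v
    ls-last x []      v = refl
    ls-last x (y ∷ l) v = ls-last y l v
    single : ∀ x l → Path (x ∷ l) → Chain
    single x l P = record
      { links = (x ∷ l) ∷ [] ; good = P ∷ [] ; s = x ; e = last x l ; J = λ _ → 0
      ; heads = λ v → +-identityʳ _ ; lasts = λ v → trans (+-identityʳ _) (ls-last x l v) }

  -- Any vertex `h` may be named as the initial hole, since every target is positive.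
  rooted : X → ∀ L → (∀ a b → gc L a b ≤ 1) → (∀ a → gc L a a ≡ 0) → Rooted (gc L)
  rooted h L simple loopless with decompose (length L) L (λ v → target (deg L v)) h ≤-refl simple loopless
                                    (λ v → target-parity (deg L v)) (λ v _ _ → 1≤target (deg L v))
  ... | D , Ps , ec≡ , ends≡ with chains Ps
  ...   | Cs , Cs-edges , Cs-weights = record
    { tail   = root O.paths
    ; path-v = root-path O.paths O.good
    ; edges≡ = λ a b → trans (sym (+-identityʳ _)) (trans (cong (∑ (λ v → ec (v ∷ root O.paths v) a b) vertices +_) (sym (take-edges a b O.paths)))
        (trans (∑-root (λ p → ec p a b) O.paths O.good O.hd≤1)
          (trans (cong (∑ (λ p → ec p a b) O.paths +_) (trans (∑-cong (λ v → trans (+-identityʳ _) (link-0ʳ (δ v) a b)) vertices) (∑-0 vertices)))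
            (trans (+-identityʳ _) (trans (O.edges≡ a b) (trans (Cs-edges a b) (ec≡ a b)))))))
    -- At most one oriented path and one added one-vertex path finish at `w`.
    ; fibre≤ = λ w → ≤-trans (m≤m+n _ _) (≤-trans (≤-reflexive (∑-root (λ p → ls p w) O.paths O.good O.hd≤1))
        (+-mono-≤ (O.ls≤1 w) (≤-reflexive (once w))))
    }
    where
    module O = Oriented (orient (length Cs) Cs ≤-refl
      (λ v → subst (_≤ 2) (sym (trans (Cs-weights v) (ends≡ v))) (target≤2 (deg L v))))
    take-edges : ∀ a b D → ∑ (λ p → ec (take 1 p) a b) D ≡ 0
    take-edges a b []            = refl
    take-edges a b ([] ∷ D)      = take-edges a b D
    take-edges a b ((x ∷ _) ∷ D) = trans (cong (λ z → z + 0 + ∑ (λ p → ec (take 1 p) a b) D) (link-0ʳ (δ x) a b)) (take-edges a b D)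

-- From edge counts to path decompositions.

∑-lookup : {A : Set} (f : A → ℕ) (l : List A) → 1 ≤ ∑ f l → ∃ λ i → 1 ≤ f (lookup l i)
∑-lookup f (x ∷ l) p with pos-+ {f x} p
... | inj₁ q = zero , q
... | inj₂ q with ∑-lookup f l q
...   | i , r = suc i , r

lookup≤∑ : {A : Set} (f : A → ℕ) (l : List A) → ∀ i → f (lookup l i) ≤ ∑ f l
lookup≤∑ f (x ∷ l) zero    = m≤m+n _ _
lookup≤∑ f (x ∷ l) (suc i) = ≤-trans (lookup≤∑ f l i) (m≤n+m _ _)

lookup+lookup≤∑ : {A : Set} (f : A → ℕ) (l : List A) → ∀ i j → i ≢ j → f (lookup l i) + f (lookup l j) ≤ ∑ f l
lookup+lookup≤∑ f (x ∷ l) zero    zero    ne = ⊥-elim (ne refl)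
lookup+lookup≤∑ f (x ∷ l) zero    (suc j) ne = +-monoʳ-≤ (f x) (lookup≤∑ f l j)
lookup+lookup≤∑ f (x ∷ l) (suc i) zero    ne = subst (_≤ f x + ∑ f l) (+-comm (f x) _) (+-monoʳ-≤ (f x) (lookup≤∑ f l i))
lookup+lookup≤∑ f (x ∷ l) (suc i) (suc j) ne =
  ≤-trans (lookup+lookup≤∑ f l i j (λ e → ne (cong suc e))) (m≤n+m _ _)

lookup-All : {A : Set} {Q : A → Set} {l : List A} → All Q l → ∀ i → Q (lookup l i)
lookup-All (q ∷ _)  zero    = q
lookup-All (_ ∷ qs) (suc i) = lookup-All qs i

adjacency : {X : Set} → Graph X → X → X → ℕ
adjacency G a b = if adj G a b then 1 else 0

adjacency-sym : {X : Set} (G : Graph X) → ∀ a b → adjacency G a b ≡ adjacency G b a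
adjacency-sym G a b = cong (if_then 1 else 0) (Graph.adj-sym G a b)

adjacency≤1 : {X : Set} (G : Graph X) → ∀ a b → adjacency G a b ≤ 1
adjacency≤1 G a b with adj G a b
... | true  = ≤-refl
... | false = z≤n

adjacency-loop : {X : Set} (G : Graph X) → ∀ a → adjacency G a a ≡ 0
adjacency-loop G a rewrite Graph.adj-irr G a = refl

module FromCounts {X : Set} (_≟_ : DecidableEquality X) where
  open Counting _≟_

  Long : List X → Set
  Long p = Path p × 2 ≤ length p

  occ-unique : ∀ l → (∀ v → occ l v ≤ 1) → Unique l
  occ-unique []      h = []
  occ-unique (x ∷ l) h = fresh l (n≤0⇒n≡0 (≤-pred (subst (λ z → z + occ l x ≤ 1) (δ-refl x) (h x))))
    ∷ occ-unique l (λ v → ≤-trans (m≤n+m _ _) (h v))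
    where
    fresh : ∀ l → occ l x ≡ 0 → All (x ≢_) l
    fresh []      e = []
    fresh (y ∷ l) e = (λ { refl → 1+n≢0 (trans (sym (δ-refl x)) (m+n≡0⇒m≡0 (δ x x) e)) })
      ∷ fresh l (m+n≡0⇒n≡0 (δ y x) e)

  *-pos : ∀ {a b} → 1 ≤ a * b → 1 ≤ a × 1 ≤ b
  *-pos {suc a} {zero}  p rewrite *-zeroʳ a with p
  ... | ()
  *-pos {suc a} {suc b} p = s≤s z≤n , s≤s z≤n

  edge⇒ec : ∀ {l u v} → EdgeIn l u v → 1 ≤ ec l u v
  edge⇒ec (fwd {x} {y} {xs}) = ≤-trans (≤-trans (≤-reflexive (sym (cong₂ _*_ (δ-refl x) (δ-refl y)))) (m≤m+n _ _)) (m≤m+n _ _)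
  edge⇒ec (bwd {x} {y} {xs}) = ≤-trans (≤-trans (≤-reflexive (sym (cong₂ _*_ (δ-refl x) (δ-refl y)))) (m≤n+m _ (δ x y * δ y x))) (m≤m+n _ _)
  edge⇒ec (there {x} {xs} e) = ≤-trans (edge⇒ec e) (m≤n+m _ _)

  ec⇒edge : ∀ l {u v} → 1 ≤ ec l u v → EdgeIn l u v
  ec⇒edge (x ∷ l) {u} {v} p with pos-+ {link (δ x) (hd l) u v} p
  ec⇒edge (x ∷ l) {u} {v} p | inj₂ q = there (ec⇒edge l q)
  ec⇒edge (x ∷ []) {u} {v} p | inj₁ q with subst (1 ≤_) (link-0ʳ (δ x) u v) q
  ... | ()
  ec⇒edge (x ∷ y ∷ l) {u} {v} p | inj₁ q with pos-+ {δ x u * δ y v} q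
  ... | inj₁ r with *-pos {δ x u} r
  ...   | r₁ , r₂ with δ-pos {x} r₁ | δ-pos {y} r₂
  ...     | refl | refl = fwd
  ec⇒edge (x ∷ y ∷ l) {u} {v} p | inj₁ q | inj₂ r with *-pos {δ x v} r
  ...   | r₁ , r₂ with δ-pos {x} r₁ | δ-pos {y} r₂
  ...     | refl | refl = bwd

  linked : (G : Graph X) → ∀ {p} → Path p → (∀ {u v} → EdgeIn p u v → adj G u v ≡ true) → Linked G p
  linked G (path {x} {l} _) h = go x l h
    where
    go : ∀ x l → (∀ {u v} → EdgeIn (x ∷ l) u v → adj G u v ≡ true) → Linked G (x ∷ l)
    go x []      h = one
    go x (y ∷ l) h = step (h fwd) (go y l (λ e → h (there e)))

  -- A positive count forces adjacency along the paths; adjacency forces a positive count and so a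
  -- covering path; a count of at most one excludes a second path on the same edge.
  decomposition : (G : Graph X) → ∀ D → All Long D →
    (∀ a b → ∑ (λ p → ec p a b) D ≡ adjacency G a b) → IsPathDecomposition G D
  decomposition G D long ec≡ = record
    { paths = λ i → record
      { nontrivial = proj₂ (lookup-All long i)
      ; distinct   = occ-unique _ (path-occ (proj₁ (lookup-All long i)))
      ; linked     = linked G (proj₁ (lookup-All long i)) (λ {u} {v} e → adjacent (≤-trans (edge⇒ec e)
          (≤-trans (lookup≤∑ (λ p → ec p u v) D i) (≤-reflexive (ec≡ u v)))))
      }
    ; covers = λ u v uv → let i , p = ∑-lookup (λ p → ec p u v) D
                                        (subst (1 ≤_) (sym (trans (ec≡ u v) (cong (if_then 1 else 0) uv))) ≤-refl)
                          in i , ec⇒edge (lookup D i) p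
    ; disjoint = λ i j u v i≢j p q → <⇒≱ (s≤s (≤-trans (+-mono-≤ (edge⇒ec p) (edge⇒ec q))
        (≤-trans (lookup+lookup≤∑ (λ p → ec p u v) D i j i≢j) (≤-trans (≤-reflexive (ec≡ u v)) (adjacency≤1 G u v))))) ≤-refl
    }
    where
    adjacent : ∀ {u v} → 1 ≤ adjacency G u v → adj G u v ≡ true
    adjacent {u} {v} p with adj G u v
    ... | true = refl

-- The edges of `H` as a list.

occ-allFin : ∀ n (v : Fin n) → Counting.occ Fin._≟_ (allFin n) v ≡ 1
occ-allFin (suc n) v = trans (cong (λ l → δ zero v + occ l v) (sym (map-tabulate (λ i → i) suc))) (split v)
  where
  open Counting (Fin._≟_ {suc n})
  split : ∀ v → δ zero v + occ (map suc (allFin n)) v ≡ 1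
  split zero    = cong suc (trans (∑-map (λ x → δ x zero) suc (allFin n)) (∑-0 (allFin n)))
  split (suc v) = trans (∑-map (λ x → δ x (suc v)) suc (allFin n)) (occ-allFin n v)

length-allFin : ∀ n → length (allFin n) ≡ n
length-allFin n = length-tabulate (λ i → i)

module EdgeList {n : ℕ} (H : Graph (Fin n)) where
  open Counting (Fin._≟_ {n})
  open Decomposing Fin._≟_ (allFin n) (occ-allFin n)

  -- Only increasing pairs are listed, as `gc` reads a listed pair in both directions.
  upper : Fin n → Fin n → Bool
  upper a b = does (a Fin.<? b) ∧ adj H a b

  ordered : Fin n → Fin n → List (Fin n × Fin n)
  ordered a b = if upper a b then (a , b) ∷ [] else []

  edgeList : List (Fin n × Fin n)
  edgeList = concatMap (λ a → concatMap (ordered a) (allFin n)) (allFin n)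

  w : Fin n → Fin n → ℕ
  w a b = if upper a b then 1 else 0

  gc-ordered : ∀ a b u v → ∑ (λ (x , y) → link (δ x) (δ y) u v) (ordered a b) ≡
    δ a u * (w a b * δ b v) + δ a v * (w a b * δ b u)
  gc-ordered a b u v with upper a b
  ... | true  = eq (δ a u) (δ b v) (δ a v) (δ b u)
    where
    eq : ∀ p q r s → p * q + r * s + 0 ≡ p * (1 * q) + r * (1 * s)
    eq = solve-∀
  ... | false rewrite *-zeroʳ (δ a u) | *-zeroʳ (δ a v) = refl

  gc-edgeList : ∀ u v → gc edgeList u v ≡ adjacency H u v
  gc-edgeList u v = begin
    gc edgeList u v
      ≡⟨ trans (∑-concatMap _ _ (allFin n)) (∑-cong (λ a → trans (∑-concatMap _ (ordered a) (allFin n)) (row a)) (allFin n)) ⟩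
    ∑ (λ a → w a v * δ a u + w a u * δ a v) (allFin n)
      ≡⟨ ∑-+ _ _ (allFin n) ⟩
    ∑ (λ a → w a v * δ a u) (allFin n) + ∑ (λ a → w a u * δ a v) (allFin n)
      ≡⟨ cong₂ _+_ (∑-δ (λ a → w a v) u) (∑-δ (λ a → w a u) v) ⟩
    w u v + w v u
      ≡⟨ both u v ⟩
    adjacency H u v ∎
    where
    open ≡-Reasoning
    row : ∀ a → ∑ (λ b → ∑ (λ (x , y) → link (δ x) (δ y) u v) (ordered a b)) (allFin n) ≡ w a v * δ a u + w a u * δ a v
    row a = trans (∑-cong (λ b → gc-ordered a b u v) (allFin n)) (trans (∑-+ _ _ (allFin n))
      (cong₂ _+_ (half u v) (half v u)))
      where
      half : ∀ u v → ∑ (λ b → δ a u * (w a b * δ b v)) (allFin n) ≡ w a v * δ a u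
      half u v = trans (∑-*ˡ (δ a u) _ (allFin n)) (trans (cong (δ a u *_) (∑-δ (w a) v)) (*-comm (δ a u) (w a v)))
    both : ∀ u v → w u v + w v u ≡ adjacency H u v
    both u v with <-cmp (toℕ u) (toℕ v)
    ... | tri< p _ ¬q rewrite dec-true (u Fin.<? v) p | dec-false (v Fin.<? u) ¬q = +-identityʳ _
    ... | tri> ¬p _ q rewrite dec-false (u Fin.<? v) ¬p | dec-true (v Fin.<? u) q = adjacency-sym H v u
    ... | tri≈ ¬p e ¬q rewrite dec-false (u Fin.<? v) ¬p | dec-false (v Fin.<? u) ¬q with Fin.toℕ-injective e
    ...   | refl = sym (adjacency-loop H u)

-- Counts of sequences mapped along an injection.

module Transport {X Y : Set} (_≟X_ : DecidableEquality X) (_≟Y_ : DecidableEquality Y) (g : X → Y)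
                 (iso : ∀ x y → Counting.δ _≟Y_ (g x) (g y) ≡ Counting.δ _≟X_ x y) where
  module X = Counting _≟X_
  module Y = Counting _≟Y_

  hd-map : ∀ l v → Y.hd (map g l) (g v) ≡ X.hd l v
  hd-map []      v = refl
  hd-map (x ∷ _) v = iso x v

  occ-map : ∀ l v → Y.occ (map g l) (g v) ≡ X.occ l v
  occ-map l v = trans (∑-map _ g l) (∑-cong (λ x → iso x v) l)

  ec-map : ∀ l a b → Y.ec (map g l) (g a) (g b) ≡ X.ec l a b
  ec-map []      a b = refl
  ec-map (x ∷ l) a b = cong₂ _+_
    (cong₂ _+_ (cong₂ _*_ (iso x a) (hd-map l b)) (cong₂ _*_ (iso x b) (hd-map l a))) (ec-map l a b)

  Outside : Y → Set
  Outside y = ∀ x → Y.δ (g x) y ≡ 0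

  hd-outside : ∀ {y} → Outside y → ∀ l → Y.hd (map g l) y ≡ 0
  hd-outside o []      = refl
  hd-outside o (x ∷ _) = o x

  occ-outside : ∀ {y} → Outside y → ∀ l → Y.occ (map g l) y ≡ 0
  occ-outside o l = trans (∑-map _ g l) (trans (∑-cong o l) (∑-0 l))

  ec-outside : ∀ {y} → Outside y → ∀ l b → Y.ec (map g l) y b ≡ 0
  ec-outside     o []      b = refl
  ec-outside {y} o (x ∷ l) b rewrite o x | hd-outside o l | *-zeroʳ (Y.δ (g x) b) = ec-outside o l b

-- Building the paths of the product layer by layer.

module Layers {n : ℕ} (H : Graph (Fin n))
              (R : Rooting.Rooted Fin._≟_ (allFin n) (occ-allFin n) (adjacency H)) where
  open Rooting.Rooted R
  open Decomposing Fin._≟_ (allFin n) (occ-allFin n) using (∑-δ)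

  V : Set
  V = Fin n

  W : ℕ → Set
  W k = Fin k × V

  -- Built from the tests of the coordinates, so that `δ` on shifted and on bottom vertices computes
  -- to `δ` on the originals.
  _≟W_ : ∀ {k} → DecidableEquality (W k)
  (i , v) ≟W (j , w) = map′ (λ (p , q) → cong₂ _,_ p q) (λ e → cong proj₁ e , cong proj₂ e) ((i Fin.≟ j) ×-dec (v Fin.≟ w))

  module C {k : ℕ} = Counting (_≟W_ {k})
  module CV = Counting (Fin._≟_ {n})
  open C using (δ; hd; ls; occ; ec; ends; link; Path; path)
  open module FC {k : ℕ} = FromCounts (_≟W_ {k}) using (Long; decomposition)

  shift : ∀ {k} → W k → W (suc k)
  shift (i , v) = suc i , v

  bottom : ∀ {k} → V → W (suc k)
  bottom v = zero , v

  module Shift {k : ℕ} = Transport (_≟W_ {k}) (_≟W_ {suc k}) shift (λ _ _ → refl)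
  module Bottom {k : ℕ} = Transport (Fin._≟_ {n}) (_≟W_ {suc k}) bottom (λ _ _ → refl)

  adj□ : ∀ k → W k → W k → ℕ
  adj□ k = adjacency (P k □ H)

  isYes-≡ : {A B : Set} (a? : Dec A) (b? : Dec B) → does a? ≡ does b? → ⌊ a? ⌋ ≡ ⌊ b? ⌋
  isYes-≡ a? b? e = trans (isYes≗does a?) (trans e (sym (isYes≗does b?)))

  adj□-shift : ∀ {k} (x y : W k) → adj□ (suc k) (shift x) (shift y) ≡ adj□ k x y
  adj□-shift (i , v) (j , w) = cong (if_then 1 else 0) (cong₂ _∨_
    (cong (_∧ ⌊ v Fin.≟ w ⌋) (cong₂ _∨_ (isYes-≡ (suc (toℕ j) ≟ suc (suc (toℕ i))) (toℕ j ≟ suc (toℕ i)) refl)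
                                         (isYes-≡ (suc (toℕ i) ≟ suc (suc (toℕ j))) (toℕ i ≟ suc (toℕ j)) refl)))
    (cong (adj H v w ∧_) (isYes-≡ (suc i Fin.≟ suc j) (i Fin.≟ j) refl)))

  adj□-bottom : ∀ {k} v w → adj□ (suc k) (bottom v) (bottom w) ≡ adjacency H v w
  adj□-bottom v w with adj H v w
  ... | true  = refl
  ... | false = refl

  adj□-vertical : ∀ {k} v w → adj□ (suc (suc k)) (bottom v) (shift (bottom w)) ≡ CV.δ v w
  adj□-vertical v w with adj H v w | v Fin.≟ w
  ... | true  | yes _ = refl
  ... | true  | no _  = refl
  ... | false | yes _ = refl
  ... | false | no _  = refl

  adj□-far : ∀ {k} v (x : W k) → adj□ (suc (suc k)) (bottom v) (shift (shift x)) ≡ 0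
  adj□-far v (i , w) with adj H v w
  ... | true  = refl
  ... | false = refl

  fin : List V
  fin = allFin n

  -- New layers are added at index 0, and the paths core v are listed from their active end, which
  -- lies in that layer.
  record Cover (k : ℕ) : Set where
    field
      core      : V → List (W (suc k))
      core-path : ∀ v → Path (core v)
      core-hd   : ∀ v x → hd (core v) x ≡ δ (bottom v) x
      finished  : List (List (W (suc k)))
      long      : All Long finished
      edges     : ∀ x y → ∑ (λ v → ec (core v) x y) fin + ∑ (λ p → ec p x y) finished ≡ adj□ (suc k) x y
      count     : 2 * length finished ≤ k * n

  -- A cover of k+1 layers whose n active paths have been extended into a further layer and
  -- have traversed it; several of them may now end at the same vertex.
  record Crossing (k : ℕ) : Set where
    field
      ext       : V → List (W (2 + k))
      ext-long  : ∀ v → Long (ext v)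
      end       : V → V
      ext-hd    : ∀ v x → hd (ext v) x ≡ δ (bottom (end v)) x
      fibre     : ∀ w → ∑ (λ v → CV.δ (end v) w) fin ≤ 2
      finished  : List (List (W (2 + k)))
      long      : All Long finished
      edges     : ∀ x y → ∑ (λ v → ec (ext v) x y) fin + ∑ (λ p → ec p x y) finished ≡ adj□ (2 + k) x y
      count     : 2 * length finished ≤ k * n

  -- Each `v` is the active end of its own path; read towards that end, the path is the reverse of
  -- `v ∷ tail v`. It may be a one-vertex path, as it has yet to climb.
  lowest : Cover 0
  lowest = record
    { core      = λ v → map bottom (v ∷ tail v)
    ; core-path = λ v → C.path (λ { (zero , w) → subst (_≤ 1) (sym (Bottom.occ-map (v ∷ tail v) w)) (CV.path-occ (path-v v) w) })
    ; core-hd   = λ v x → refl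
    ; finished  = []
    ; long      = []
    ; edges     = λ { (zero , a) (zero , b) → trans (+-identityʳ _) (trans (∑-cong (λ v → Bottom.ec-map (v ∷ tail v) a b) fin)
                        (trans (edges≡ a b) (sym (adj□-bottom {0} a b)))) }
    ; count     = z≤n
    }

  reverse-∷ : {A : Set} (x : A) (l : List A) → ∃₂ λ y r → reverse (x ∷ l) ≡ y ∷ r
  reverse-∷ x l rewrite unfold-reverse x l with reverse l
  ... | []    = x , [] , refl
  ... | y ∷ r = y , r ∷ʳ x , refl

  ec-sym : ∀ {k} (l : List (W k)) x y → ec l x y ≡ ec l y x
  ec-sym []      x y = refl
  ec-sym (z ∷ l) x y = cong₂ _+_ (+-comm (δ z x * hd l y) (δ z y * hd l x)) (ec-sym l x y)

  -- Every vertex is the active end of exactly one path, so each vertical edge into the new layer is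
  -- climbed once. The path arriving at `v` continues along the rooted path of `v`, listed backwards
  -- since lists begin at the active end. Parts in different layers are disjoint, so simplicity is
  -- checked layer by layer.
  cross : ∀ {k} → Cover k → Crossing k
  cross {k} C = record
    { ext      = ext
    ; ext-long = λ v → path-of (ext v) (long-ext v) (occ≤1 v)
    ; end      = end
    ; ext-hd   = ext-hd
    ; fibre    = λ w → subst (_≤ 2) (∑-cong (λ v → trans (sym (CV.hd-reverse (v ∷ tail v) w))
                   (cong (λ l → CV.hd l w) (proj₂ (proj₂ (reverse-∷ v (tail v)))))) fin) (fibre≤ w)
    ; finished = map (map shift) finished
    ; long     = All.map⁺ (shift-long long)
    ; edges    = total
    ; count    = subst (λ z → 2 * z ≤ k * n) (sym (length-map (map shift) finished)) count
    }
    where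
    open Cover C

    ext : V → List (W (2 + k))
    ext v = map bottom (reverse (tail v)) ++ bottom v ∷ map shift (core v)

    end : V → V
    end v = proj₁ (reverse-∷ v (tail v))

    layer : ∀ v → map bottom (reverse (tail v)) ++ bottom v ∷ [] ≡ map (bottom {suc k}) (reverse (v ∷ tail v))
    layer v = trans (sym (map-++ bottom (reverse (tail v)) (v ∷ []))) (cong (map bottom) (sym (unfold-reverse v (tail v))))

    ext-hd : ∀ v x → hd (ext v) x ≡ δ (bottom (end v)) x
    ext-hd v x = trans (hd-first (map bottom (reverse (tail v)))) (trans (cong (λ l → hd l x) (layer v))
      (cong (λ l → hd (map bottom l) x) (proj₂ (proj₂ (reverse-∷ v (tail v))))))
      where
      hd-first : ∀ l {r} → hd (l ++ bottom v ∷ r) x ≡ hd (l ++ bottom v ∷ []) x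
      hd-first []      = refl
      hd-first (_ ∷ _) = refl

    -- Even a one-vertex core gains a vertical edge, so every path that may stop after this is
    -- nontrivial.
    long-ext : ∀ v → 2 ≤ length (ext v)
    long-ext v = subst (2 ≤_) (sym (length-++ (map bottom (reverse (tail v)))))
      (≤-trans (s≤s (subst (1 ≤_) (sym (length-map shift (core v))) (nonempty (core-path v)))) (m≤n+m _ _))
      where
      nonempty : ∀ {l : List (W (suc k))} → Path l → 1 ≤ length l
      nonempty (C.path _) = s≤s z≤n

    path-of : ∀ l → 2 ≤ length l → (∀ x → occ l x ≤ 1) → Long l
    path-of (x ∷ l) p h = C.path h , p

    occ≤1 : ∀ v x → occ (ext v) x ≤ 1
    occ≤1 v x = subst (_≤ 1) (sym (C.occ-++ (map bottom (reverse (tail v))) _ x)) (bound x)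
      where
      bound : ∀ x → occ (map bottom (reverse (tail v))) x + (δ (bottom v) x + occ (map shift (core v)) x) ≤ 1
      bound (zero , w) rewrite Bottom.occ-map {suc k} (reverse (tail v)) w | CV.occ-reverse (tail v) w
        | Shift.occ-outside {y = bottom w} (λ _ → refl) (core v) | +-identityʳ (CV.δ v w) =
        subst (_≤ 1) (+-comm (CV.δ v w) _) (CV.path-occ (path-v v) w)
      bound (suc i , w) rewrite Bottom.occ-outside {y = suc i , w} (λ _ → refl) (reverse (tail v))
        | Shift.occ-map (core v) (i , w) = C.path-occ (core-path v) (i , w)

    shift-long : ∀ {D : List (List (W (suc k)))} → All Long D → All (λ p → Long (map shift p)) D
    shift-long []                                = []
    shift-long (_∷_ {x = l} (P , p) Ps) =
      path-of (map shift l) (subst (2 ≤_) (sym (length-map shift l)) p) (shifted l (C.path-occ P)) ∷ shift-long Ps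
      where
      shifted : ∀ l → (∀ x → occ l x ≤ 1) → ∀ x → occ (map shift l) x ≤ 1
      shifted l h (zero , w)  = subst (_≤ 1) (sym (Shift.occ-outside {y = bottom w} (λ _ → refl) l)) z≤n
      shifted l h (suc i , w) = subst (_≤ 1) (sym (Shift.occ-map l (i , w))) (h (i , w))

    ec-ext : ∀ v x y → ec (ext v) x y ≡ ec (map bottom (v ∷ tail v)) x y
      + (link (δ (bottom v)) (hd (map shift (core v))) x y + ec (map shift (core v)) x y)
    ec-ext v x y = begin
      ec (l ++ bottom v ∷ r) x y
        ≡⟨ C.ec-++ l (bottom v ∷ r) x y ⟩
      ec l x y + link (ls l) (δ (bottom v)) x y + (link (δ (bottom v)) (hd r) x y + ec r x y)
        ≡⟨ cong (_+ (link (δ (bottom v)) (hd r) x y + ec r x y)) lower ⟩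
      ec (map bottom (v ∷ tail v)) x y + (link (δ (bottom v)) (hd r) x y + ec r x y) ∎
      where
      open ≡-Reasoning
      l r : List (W (2 + k))
      l = map bottom (reverse (tail v))
      r = map shift (core v)
      lower : ec l x y + link (ls l) (δ (bottom v)) x y ≡ ec (map bottom (v ∷ tail v)) x y
      lower = begin
        ec l x y + link (ls l) (δ (bottom v)) x y
          ≡⟨ +-identityʳ _ ⟨
        ec l x y + link (ls l) (δ (bottom v)) x y + 0
          ≡⟨ cong (ec l x y + link (ls l) (δ (bottom v)) x y +_) (trans (+-identityʳ _) (C.link-0ʳ (δ (bottom v)) x y)) ⟨
        ec l x y + link (ls l) (δ (bottom v)) x y + ec (bottom v ∷ []) x y
          ≡⟨ C.ec-++ l (bottom v ∷ []) x y ⟨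
        ec (l ++ bottom v ∷ []) x y
          ≡⟨ cong (λ z → ec z x y) (trans (layer v) (reverse-map bottom (v ∷ tail v))) ⟩
        ec (reverse (map bottom (v ∷ tail v))) x y
          ≡⟨ C.ec-reverse (map bottom (v ∷ tail v)) x y ⟩
        ec (map bottom (v ∷ tail v)) x y ∎

    count-at : W (2 + k) → W (2 + k) → ℕ
    count-at x y = ∑ (λ v → ec (ext v) x y) fin + ∑ (λ p → ec p x y) (map (map shift) finished)

    count-at-sym : ∀ x y → count-at x y ≡ count-at y x
    count-at-sym x y = cong₂ _+_ (∑-cong (λ v → ec-sym (ext v) x y) fin) (∑-cong (λ p → ec-sym p x y) (map (map shift) finished))

    vertical : ∀ a (x : W (suc k)) → δ (bottom a) x ≡ adj□ (2 + k) (bottom a) (shift x)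
    vertical a (zero , b)  = sym (adj□-vertical {k} a b)
    vertical a (suc i , b) = sym (adj□-far a (i , b))

    finished-outside : ∀ {x} → Shift.Outside x → ∀ y → ∑ (λ p → ec p x y) (map (map shift) finished) ≡ 0
    finished-outside o y = trans (∑-map _ (map shift) finished) (trans (∑-cong (λ p → Shift.ec-outside o p y) finished) (∑-0 finished))

    -- Between the new layer and the older ones only the vertical step of `ext v` contributes, and
    -- only for `v` equal to `a`.
    total-up : ∀ a (x : W (suc k)) → count-at (bottom a) (shift x) ≡ adj□ (2 + k) (bottom a) (shift x)
    total-up a x = trans (cong₂ _+_ (trans (∑-cong edge fin) (∑-δ (λ v → δ (bottom v) x) a)) (finished-outside (λ _ → refl) (shift x)))
      (trans (+-identityʳ _) (vertical a x))
      where
      edge : ∀ v → ec (ext v) (bottom a) (shift x) ≡ δ (bottom v) x * CV.δ v a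
      edge v rewrite ec-ext v (bottom a) (shift x)
        | ec-sym (map bottom (v ∷ tail v)) (bottom a) (shift x)
        | Bottom.ec-outside {y = shift x} (λ _ → refl) (v ∷ tail v) (bottom a)
        | Shift.ec-outside {y = bottom a} (λ _ → refl) (core v) (shift x)
        | Shift.hd-map (core v) x | core-hd v x
        = eq (CV.δ v a) (δ (bottom v) x)
        where
        eq : ∀ p q → p * q + 0 + 0 ≡ q * p
        eq = solve-∀

    total : ∀ x y → count-at x y ≡ adj□ (2 + k) x y
    total (zero , a) (zero , b) = trans (cong₂ _+_ (∑-cong edge fin) (finished-outside (λ _ → refl) (bottom b)))
      (trans (+-identityʳ _) (trans (edges≡ a b) (sym (adj□-bottom {suc k} a b))))
      where
      edge : ∀ v → ec (ext v) (bottom a) (bottom b) ≡ CV.ec (v ∷ tail v) a b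
      edge v rewrite ec-ext v (bottom a) (bottom b)
        | Bottom.ec-map {suc k} (v ∷ tail v) a b
        | Shift.ec-outside {y = bottom a} (λ _ → refl) (core v) (bottom b)
        | Shift.hd-outside {y = bottom a} (λ _ → refl) (core v)
        | Shift.hd-outside {y = bottom b} (λ _ → refl) (core v)
        | *-zeroʳ (CV.δ v a) | *-zeroʳ (CV.δ v b) = +-identityʳ _
    total (zero , a) (suc j , b) = total-up a (j , b)
    total (suc i , a) (zero , b) = trans (count-at-sym (suc i , a) (zero , b))
      (trans (total-up b (i , a)) (adjacency-sym (P (2 + k) □ H) (zero , b) (suc i , a)))
    total (suc i , a) (suc j , b) = trans (cong₂ _+_ (∑-cong edge fin)
        (trans (∑-map _ (map shift) finished) (∑-cong (λ p → Shift.ec-map p (i , a) (j , b)) finished)))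
      (trans (edges (i , a) (j , b)) (sym (adj□-shift (i , a) (j , b))))
      where
      edge : ∀ v → ec (ext v) (suc i , a) (suc j , b) ≡ ec (core v) (i , a) (j , b)
      edge v rewrite ec-ext v (suc i , a) (suc j , b)
        | Bottom.ec-outside {y = suc i , a} (λ _ → refl) (v ∷ tail v) (suc j , b) =
        Shift.ec-map (core v) (i , a) (j , b)

  -- At each vertex w of the new layer one path ending there stays active (a trivial one if there is
  -- none) and at most one other is finished: this is where the bound n/2 per layer comes from.
  regroup : ∀ {k} → Crossing k → Cover (suc k)
  regroup {k} X = record
    { core      = λ w → top w (at w)
    ; core-path = λ w → top-path w (at w)
    ; core-hd   = λ w x → top-hd w (at w) (All.all-filter (λ v → end v Fin.≟ w) fin) x
    ; finished  = stopped ++ finished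
    ; long      = All.++⁺ (All.concat⁺ (All.map⁺ (universal (λ w → All.map⁺ (universal ext-long (drop 1 (at w)))) fin))) long
    ; edges     = total
    ; count     = subst (_≤ n + k * n) (sym (trans (cong (2 *_) (length-++ stopped)) (*-distribˡ-+ 2 (length stopped) (length finished))))
                    (+-mono-≤ stopped≤ count)
    }
    where
    open Crossing X

    at : V → List V
    at w = filter (λ v → end v Fin.≟ w) fin

    top : V → List V → List (W (2 + k))
    top w []      = bottom w ∷ []
    top w (v ∷ _) = ext v

    stopped : List (List (W (2 + k)))
    stopped = concatMap (λ w → map ext (drop 1 (at w))) fin

    top-path : ∀ w F → Path (top w F)
    top-path w []      = C.path (λ x → subst (_≤ 1) (sym (+-identityʳ _)) (C.δ≤1 (bottom w) x))
    top-path w (v ∷ _) = proj₁ (ext-long v)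

    top-hd : ∀ w F → All (λ v → end v ≡ w) F → ∀ x → hd (top w F) x ≡ δ (bottom w) x
    top-hd w []      _          x = refl
    top-hd w (v ∷ _) (refl ∷ _) x = ext-hd v x

    ∑-at : ∀ (f : V → ℕ) w → ∑ f (at w) ≡ ∑ (λ v → f v * CV.δ (end v) w) fin
    ∑-at f w = go fin
      where
      go : ∀ l → ∑ f (filter (λ v → end v Fin.≟ w) l) ≡ ∑ (λ v → f v * CV.δ (end v) w) l
      go []      = refl
      go (v ∷ l) with end v Fin.≟ w
      ... | yes _ = cong₂ _+_ (sym (*-identityʳ (f v))) (go l)
      ... | no _  = trans (go l) (cong (_+ ∑ (λ v → f v * CV.δ (end v) w) l) (sym (*-zeroʳ (f v))))

    -- Each vertex lies in exactly one fibre of `end`.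
    ∑-fibres : ∀ (f : V → ℕ) → ∑ (λ w → ∑ f (at w)) fin ≡ ∑ f fin
    ∑-fibres f = trans (∑-cong (∑-at f) fin) (trans (∑-swap (λ w v → f v * CV.δ (end v) w) fin fin)
      (∑-cong (λ v → trans (∑-*ˡ (f v) (CV.δ (end v)) fin) (trans (cong (f v *_)
        (trans (∑-cong (CV.δ-sym (end v)) fin) (occ-allFin n (end v)))) (*-identityʳ (f v)))) fin))

    top+rest : ∀ w F x y → ec (top w F) x y + ∑ (λ v → ec (ext v) x y) (drop 1 F) ≡ ∑ (λ v → ec (ext v) x y) F
    top+rest w []      x y = trans (+-identityʳ _) (trans (+-identityʳ _) (C.link-0ʳ (δ (bottom w)) x y))
    top+rest w (v ∷ F) x y = refl

    total : ∀ x y → ∑ (λ w → ec (top w (at w)) x y) fin + ∑ (λ p → ec p x y) (stopped ++ finished) ≡ adj□ (2 + k) x y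
    total x y = begin
      T + ∑ (λ p → ec p x y) (stopped ++ finished)
        ≡⟨ cong (T +_) (∑-++ _ stopped finished) ⟩
      T + (∑ (λ p → ec p x y) stopped + S)
        ≡⟨ +-assoc T _ S ⟨
      T + ∑ (λ p → ec p x y) stopped + S
        ≡⟨ cong (λ z → T + z + S) (trans (∑-concatMap _ _ fin) (∑-cong (λ w → ∑-map _ ext (drop 1 (at w))) fin)) ⟩
      T + ∑ (λ w → ∑ (λ v → ec (ext v) x y) (drop 1 (at w))) fin + S
        ≡⟨ cong (_+ S) (∑-+ _ _ fin) ⟨
      ∑ (λ w → ec (top w (at w)) x y + ∑ (λ v → ec (ext v) x y) (drop 1 (at w))) fin + S
        ≡⟨ cong (_+ S) (trans (∑-cong (λ w → top+rest w (at w) x y) fin) (∑-fibres (λ v → ec (ext v) x y))) ⟩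
      ∑ (λ v → ec (ext v) x y) fin + S
        ≡⟨ edges x y ⟩
      adj□ (2 + k) x y ∎
      where
      open ≡-Reasoning
      T S : ℕ
      T = ∑ (λ w → ec (top w (at w)) x y) fin
      S = ∑ (λ p → ec p x y) finished

    at≤2 : ∀ w → length (at w) ≤ 2
    at≤2 w = subst (_≤ 2) (trans (trans (∑-cong (λ v → sym (*-identityˡ _)) fin) (sym (∑-at (λ _ → 1) w))) (∑-1 (at w))) (fibre w)

    -- A fibre of size one stops no path and a fibre of size two stops one. Twice the number of
    -- stopped paths is thus at most the fibre size, and the sizes add up to `n`.
    drop-one : ∀ (F : List V) → length F ≤ 2 → 2 * length (drop 1 F) ≤ length F
    drop-one []              _ = z≤n
    drop-one (_ ∷ [])        _ = z≤n
    drop-one (_ ∷ _ ∷ [])    _ = ≤-refl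
    drop-one (_ ∷ _ ∷ _ ∷ _) (s≤s (s≤s ()))

    stopped≤ : 2 * length stopped ≤ n
    stopped≤ = begin
      2 * length stopped
        ≡⟨ cong (2 *_) (trans (sym (∑-1 stopped)) (trans (∑-concatMap (λ _ → 1) (λ w → map ext (drop 1 (at w))) fin)
             (∑-cong (λ w → trans (∑-1 (map ext (drop 1 (at w)))) (length-map ext (drop 1 (at w)))) fin))) ⟩
      2 * ∑ (λ w → length (drop 1 (at w))) fin
        ≡⟨ ∑-*ˡ 2 _ fin ⟨
      ∑ (λ w → 2 * length (drop 1 (at w))) fin
        ≤⟨ ∑-mono (λ w → drop-one (at w) (at≤2 w)) fin ⟩
      ∑ (λ w → length (at w)) fin
        ≡⟨ ∑-cong (λ w → ∑-1 (at w)) fin ⟨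
      ∑ (λ w → ∑ (λ _ → 1) (at w)) fin
        ≡⟨ trans (∑-fibres (λ _ → 1)) (trans (∑-1 fin) (length-allFin n)) ⟩
      n ∎
      where open ≤-Reasoning

  cover : ∀ k → Cover k
  cover zero    = lowest
  cover (suc k) = regroup (cross (cover k))

  -- The cover of all layers but the top one crosses into the top layer and is not regrouped there,
  -- so its `n` paths all stop. After doubling they contribute twice `n`, and the `k` inner layers
  -- at most `k * n`.
  product-decomposition : ∀ k → ∃ λ D → IsPathDecomposition (P (2 + k) □ H) D × 2 * length D ≤ (2 + k) * n
  product-decomposition k = map ext fin ++ finished
    , decomposition (P (2 + k) □ H) _ (All.++⁺ (All.map⁺ (universal ext-long fin)) long)
        (λ x y → trans (∑-++ _ (map ext fin) finished) (trans (cong (_+ ∑ (λ p → ec p x y) finished) (∑-map _ ext fin)) (edges x y)))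
    , (begin
      2 * length (map ext fin ++ finished)    ≡⟨ cong (2 *_) (trans (length-++ (map ext fin)) (cong (_+ length finished) (trans (length-map ext fin) (length-allFin n)))) ⟩
      2 * (n + length finished)               ≡⟨ eq n (length finished) ⟩
      n + (n + 2 * length finished)           ≤⟨ +-monoʳ-≤ n (+-monoʳ-≤ n count) ⟩
      n + (n + k * n)                         ∎)
    where
    open Crossing (cross (cover k))
    open ≤-Reasoning
    eq : ∀ a b → 2 * (a + b) ≡ a + (a + 2 * b)
    eq = solve-∀

theorem3p1 : (m n : ℕ) → 2 ≤ m → (H : Graph (Fin n)) → Connected H →
    Σ (List (List (Fin m × Fin n))) λ D →
    IsPathDecomposition (P m □ H) D × 2 * length D ≤ m * n
-- Naming an initial hole takes a vertex, so order zero is treated apart, with no paths at all.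
theorem3p1 (suc (suc k)) zero    (s≤s (s≤s z≤n)) H _ = [] ,
  record { paths = λ () ; covers = λ { (_ , ()) } ; disjoint = λ () } , z≤n
theorem3p1 (suc (suc k)) (suc n) (s≤s (s≤s z≤n)) H _ = Layers.product-decomposition H rooted-H k
  where
  open EdgeList H
  open Decomposing Fin._≟_ (allFin (suc n)) (occ-allFin (suc n)) using (gc)
  open Rooting Fin._≟_ (allFin (suc n)) (occ-allFin (suc n))
  rooted-H : Rooted (adjacency H)
  rooted-H = record { tail = R.tail ; path-v = R.path-v ; fibre≤ = R.fibre≤
                    ; edges≡ = λ a b → trans (R.edges≡ a b) (gc-edgeList a b) }
    where
    module R = Rooted (rooted zero edgeList
      (λ a b → subst (_≤ 1) (sym (gc-edgeList a b)) (adjacency≤1 H a b))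
      (λ a → trans (gc-edgeList a a) (adjacency-loop H a)))
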